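{- Let $X=\{x_1<\cdots<x_N\}\subset\mathbb{R}$ with $d(x,y)=|x-y|$, and consider the offline problem under elective service for an input with arrival epochs $(R_1,a_1),\ldots,(R_m,a_m)$ and initial server position $s_0\in X$. Let $F$ be the table with $F[0,s_0]=0$, $F[0,z]=+\infty$ for $z\neq s_0$, and, for $j\ge 1$ and $z\in X$, $$F[j,z]=\min_{\substack{1\le p\le j\\ y\in X}}\bigl\{F[p-1,y]+K_{p,j}(y,z)+a_j-a_p\bigr\}.$$ Then $$\operatorname{OPT}=\min_{z\in X}F[m,z].$$ If $Q$ is the number of request occurrences, the distance-transform implementation of this recurrence (described in the context) runs in $O(Q+m^2N)$ time and uses $O(mN)$ working space beyond the input, including traceback pointers.
   Context: Model. $(X,d)$ is a finite metric space and $s_0\in X$ is the initial server position. An input is a finite set of request occurrences; each request $q$ has an arrival time $a(q)\ge 0$ and a location $x(q)\in X$. The distinct arrival times are $a_1<\cdots<a_m$, and the epoch $R_h$ is the nonempty set of requests arriving at $a_h$. A walk $P=(v_0,\ldots,v_\ell)$ in $X$ ($\ell\ge 0$) is executed instantaneously at one time, visits its listed vertices, and has length $\operatorname{len}(P)=\sum_i d(v_{i-1},v_i)$; on the line, a monotone move may list all sites in between. A schedule is a finite sequence of atomic actions with nondecreasing timestamps. At time $t$ the complete epoch arriving at $t$ is processed first; then one action at $t$ performs a finite ordered sequence of walks, and no further arrival is processed until the action ends. The first walk starts at $s_0$ and every later one starts where its predecessor ended. A walk $P$ at time $t$ during which a nonempty set $B$ of pending requests is served is one service event of cost $\operatorname{len}(P)+\max_{q\in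 B}(t-a(q))$; a walk serving no request costs $\operatorname{len}(P)$. The cost of a schedule is the sum of these costs; every request must eventually be served. Elective service: a pending request may be included in $B$ only if its location is visited by $P$, but locations may be visited without serving. $\operatorname{OPT}$ is the infimum of the cost over feasible elective schedules. Kernel. For $1\le p\le j\le m$ let $L_{p,j}$ and $U_{p,j}$ be the minimum and maximum of $x(q)$ over $q\in R_p\cup\cdots\cup R_j$, and for $y,z\in X$ let $$K_{p,j}(y,z)=(U_{p,j}-L_{p,j})+\min\bigl\{|y-L_{p,j}|+|U_{p,j}-z|,\ |y-U_{p,j}|+|L_{p,j}-z|\bigr\}.$$ Distance-transform implementation. Let $G_h(x)=\min_{y\in X}\{F[h,y]+|y-x|\}$ for $x\in X$, and let $Y_h(x)$ be a deterministically chosen minimizer. First compute the minimum and maximum request location of every epoch. For each layer $h$, once $F[h,\cdot]$ is complete, compute all $G_h(x)$ and $Y_h(x)$ by one forward and one backward scan over the sorted sites. For $j=1,\ldots,m$, scan $p=j,j-1,\ldots,1$, maintaining $L=L_{p,j}$ and $U=U_{p,j}$ incrementally, and for each $z\in X$ relax $F[j,z]$ with the candidate $$(U-L)+(a_j-a_p)+\min\{G_{p-1}(L)+|U-z|,\ G_{p-1}(U)+|L-z|\},$$ storing for each state one traceback pointer ($p$, the attaining predecessor endpoint, and the winning term). Arithmetic operations and comparisons are counted at unit cost. -}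

module Defs where

open import Level using (0ℓ)
open import Algebra.Structures using (IsCommutativeRing)
open import Data.Fin using (Fin; zero; suc; toℕ; fromℕ; fromℕ<; inject₁)
import Data.Fin as Fin
import Data.Fin.Properties as Fin
open import Data.List using
  (List; []; _∷_; _++_; map; concatMap; filter; reverse; allFin; cartesianProduct; foldr)
import Data.List.Extrema as Extrema
open import Data.List.Membership.Propositional using (_∈_; _∉_)
open import Data.List.Relation.Unary.All using (All)
open import Data.List.Relation.Unary.Any using (Any)
open import Data.List.Relation.Unary.Linked using (Linked)
open import Data.Nat using (ℕ; zero; suc; NonZero; >-nonZero⁻¹)
import Data.Nat as ℕ
open import Data.Product using (Σ; ∃-syntax; _×_; _,_; proj₁; proj₂)
open import Data.Unit using (⊤)
open import Data.Vec using (Vec; []; _∷_; lookup)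
import Data.Vec as Vec
open import Relation.Binary.Bundles using (TotalOrder)
import Relation.Binary.Construct.Add.Supremum.NonStrict as AddTop
import Relation.Binary.Construct.NonStrictToStrict as ToStrict
open import Relation.Binary.PropositionalEquality using (_≡_; _≢_; refl)
open import Relation.Binary.Structures using (IsDecTotalOrder)
open import Relation.Nullary using (Dec; yes; no)
open import Relation.Nullary.Decidable using (_×-dec_)
open import Relation.Nullary.Construct.Add.Supremum using (_⁺; [_]; ⊤⁺)

-- The real line enters only as an ordered field.  The order is decidable, as
-- it is for ℝ classically and as unit-cost comparisons presuppose.
record OrderedField : Set₁ where
  infix  8 -_
  infixl 7 _*_
  infixl 6 _+_ _-_
  infix  4 _≤_ _<_ _≤⁺_
  field
    Carrier           : Set
    _+_ _*_           : Carrier → Carrier → Carrier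
    -_                : Carrier → Carrier
    0# 1#             : Carrier
    _≤_               : Carrier → Carrier → Set
    isCommutativeRing : IsCommutativeRing _≡_ _+_ _*_ -_ 0# 1#
    0≢1               : 0# ≢ 1#
    inverse           : ∀ x → x ≢ 0# → ∃[ y ] x * y ≡ 1#
    isDecTotalOrder   : IsDecTotalOrder _≡_ _≤_
    +-monoʳ-≤         : ∀ x {y z} → y ≤ z → x + y ≤ x + z
    *-nonNegative     : ∀ {x y} → 0# ≤ x → 0# ≤ y → 0# ≤ x * y

  module Order = IsDecTotalOrder isDecTotalOrder

  totalOrder : TotalOrder 0ℓ 0ℓ 0ℓ
  totalOrder = record { isTotalOrder = Order.isTotalOrder }

  open import Algebra.Construct.NaturalChoice.Min totalOrder public using (_⊓_)
  open import Algebra.Construct.NaturalChoice.Max totalOrder public using (_⊔_)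
  open Extrema totalOrder public using (min; max)

  _<_ : Carrier → Carrier → Set
  _<_ = ToStrict._<_ _≡_ _≤_

  _-_ : Carrier → Carrier → Carrier
  x - y = x + (- y)

  ∣_∣ : Carrier → Carrier
  ∣ x ∣ = x ⊔ (- x)

  Carrier⁺ : Set
  Carrier⁺ = Carrier ⁺

  _≤⁺_ : Carrier⁺ → Carrier⁺ → Set
  _≤⁺_ = AddTop._≤⁺_ _≤_

  module Order⁺ = IsDecTotalOrder (AddTop.≤⁺-isDecTotalOrder-≡ _≤_ isDecTotalOrder)

  totalOrder⁺ : TotalOrder 0ℓ 0ℓ 0ℓ
  totalOrder⁺ = record { isTotalOrder = Order⁺.isTotalOrder }

  infixl 6 _⊕_
  _⊕_ : Carrier⁺ → Carrier → Carrier⁺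
  [ x ] ⊕ y = [ x + y ]
  ⊤⁺    ⊕ _ = ⊤⁺

  minimum : {A : Set} → List A → (A → Carrier⁺) → Carrier⁺
  minimum xs f = Extrema.min totalOrder⁺ ⊤⁺ (map f xs)

  IsInfimum : (Carrier → Set) → Carrier⁺ → Set
  IsInfimum S v =
    (∀ c → S c → v ≤⁺ [ c ]) ×
    (∀ b → (∀ c → S c → b ≤⁺ [ c ]) → b ≤⁺ v)

-- N sites, m epochs, and the number of request occurrences in each epoch.
record Shape : Set where
  field
    N        : ℕ
    m        : ℕ
    size     : Fin m → ℕ
    nonempty : ∀ h → NonZero (size h)

  Request : Set
  Request = Σ (Fin m) λ h → Fin (size h)

  first : (h : Fin m) → Fin (size h)
  first h = fromℕ< (>-nonZero⁻¹ (size h) ⦃ nonempty h ⦄)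

  Q : ℕ
  Q = Vec.sum (Vec.tabulate size)

  upTo : Fin m → List (Fin m)
  upTo j = filter (Fin._≤? j) (allFin m)

  range : Fin m → Fin m → List (Fin m)
  range p j = filter (λ h → (p Fin.≤? h) ×-dec (h Fin.≤? j)) (allFin m)

  requests : Fin m → Fin m → List Request
  requests p j = concatMap (λ h → map (h ,_) (allFin (size h))) (range p j)

-- A point of X is represented by its rank in x₁ < ⋯ < x_N, and a request
-- location is given as such a rank.
record Input (R : OrderedField) (S : Shape) : Set where
  open OrderedField R
  open Shape S
  field
    site           : Fin N → Carrier
    site-mono      : ∀ {i k} → i Fin.< k → site i < site k
    s₀             : Fin N
    arrival        : Fin m → Carrier
    arrival-nonNeg : ∀ h → 0# ≤ arrival h
    arrival-mono   : ∀ {h k} → h Fin.< k → arrival h < arrival k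
    location       : (h : Fin m) → Fin (size h) → Fin N

module Model {R : OrderedField} {S : Shape} (I : Input R S) where
  open OrderedField R
  open Shape S
  open Input I

  d : Fin N → Fin N → Carrier
  d y z = ∣ site y - site z ∣

  a : Request → Carrier
  a q = arrival (proj₁ q)

  loc : Request → Fin N
  loc (h , i) = location h i

  record Walk : Set where
    constructor _then_
    field
      start : Fin N
      steps : List (Fin N)

  vertices : Walk → List (Fin N)
  vertices (v then vs) = v ∷ vs

  lengthFrom : Fin N → List (Fin N) → Carrier
  lengthFrom v []       = 0#
  lengthFrom v (w ∷ ws) = d v w + lengthFrom w ws

  endFrom : Fin N → List (Fin N) → Fin N
  endFrom v []       = v
  endFrom v (w ∷ ws) = endFrom w ws

  len : Walk → Carrier
  len (v then vs) = lengthFrom v vs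

  end : Walk → Fin N
  end (v then vs) = endFrom v vs

  -- `served` is read as a set: order and repetitions are immaterial.
  record Event : Set where
    field
      walk   : Walk
      served : List Request

  record Action : Set where
    field
      time   : Carrier
      events : List Event

  Schedule : Set
  Schedule = List Action

  timedEvents : Schedule → List (Carrier × Event)
  timedEvents = concatMap λ α → map (Action.time α ,_) (Action.events α)

  delay : Carrier → List Request → Carrier
  delay t []       = 0#
  delay t (q ∷ qs) = max (t - a q) (map (λ r → t - a r) qs)

  eventCost : Carrier × Event → Carrier
  eventCost (t , e) = len (Event.walk e) + delay t (Event.served e)

  cost : Schedule → Carrier
  cost σ = foldr (λ e c → eventCost e + c) 0# (timedEvents σ)

  Connected : Fin N → List (Carrier × Event) → Set
  Connected v []             = ⊤
  Connected v ((_ , e) ∷ es) =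
    Walk.start (Event.walk e) ≡ v × Connected (end (Event.walk e)) es

  -- The first argument lists the requests already served.
  Elective : List Request → List (Carrier × Event) → Set
  Elective D []             = ⊤
  Elective D ((t , e) ∷ es) =
    All (λ q → a q ≤ t × q ∉ D × loc q ∈ vertices (Event.walk e)) (Event.served e)
    × Elective (Event.served e ++ D) es

  record Feasible (σ : Schedule) : Set where
    field
      chronological : Linked _≤_ (map Action.time σ)
      connected     : Connected s₀ (timedEvents σ)
      elective      : Elective [] (timedEvents σ)
      complete      : ∀ q → Any (λ e → q ∈ Event.served (proj₂ e)) (timedEvents σ)

  IsOPT : Carrier⁺ → Set
  IsOPT = IsInfimum λ c → ∃[ σ ] Feasible σ × cost σ ≡ c

  -- For p ≤ j the request supplied as default belongs to the range, so these
  -- are exact extrema.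
  L U : Fin m → Fin m → Carrier
  L p j = min (site (loc (p , first p))) (map (λ q → site (loc q)) (requests p j))
  U p j = max (site (loc (p , first p))) (map (λ q → site (loc q)) (requests p j))

  K : Fin m → Fin m → Fin N → Fin N → Carrier
  K p j y z =
    (U p j - L p j) +
    ((∣ site y - L p j ∣ + ∣ U p j - site z ∣) ⊓ (∣ site y - U p j ∣ + ∣ L p j - site z ∣))

  -- Epochs are numbered from 0 and layers of the table also from 0: the layer
  -- just after epoch j is `suc j`, the one just before epoch p is `inject₁ p`.
  Table : Set
  Table = Fin (suc m) → Fin N → Carrier⁺

  record IsTable (F : Table) : Set where
    field
      F-start : F zero s₀ ≡ [ 0# ]
      F-other : ∀ z → z ≢ s₀ → F zero z ≡ ⊤⁺
      F-step  : ∀ j z → F (suc j) z ≡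
        minimum (cartesianProduct (upTo j) (allFin N))
                (λ (p , y) → F (inject₁ p) y ⊕ K p j y z ⊕ (arrival j - arrival p))

-- A unit-cost imperative language.  Program text may depend on the shape of the
-- input but not on the data, which is only reached by the input instructions
-- `siteAt`, `arrivalAt`, `locationOf` and `startSite`.  A cell holds one real,
-- one extended real, or one index.
data Sort : Set where
  real ext : Sort
  idx      : ℕ → Sort

record Array : Set where
  constructor array
  field
    sort : Sort
    rows : ℕ
    cols : ℕ

module Syntax (S : Shape) {k : ℕ} (layout : Vec Array k) where
  open Shape S

  sortOf : Fin k → Sort
  sortOf A = Array.sort (lookup layout A)

  rowsOf colsOf : Fin k → ℕ
  rowsOf A = Array.rows (lookup layout A)
  colsOf A = Array.cols (lookup layout A)

  infixl 6 _`+_ _`-_ _`⊕_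
  infix  4 _`≤_ _`≤⁺_
  infix  3 _⟨_,_⟩≔_
  infixr 2 _⨾_

  data Expr : Sort → Set where
    at         : ∀ {n} → Fin n → Expr (idx n)
    _⟨_,_⟩     : (A : Fin k) → Expr (idx (rowsOf A)) → Expr (idx (colsOf A)) → Expr (sortOf A)
    siteAt     : Expr (idx N) → Expr real
    arrivalAt  : Expr (idx m) → Expr real
    locationOf : (h : Fin m) → Fin (size h) → Expr (idx N)
    startSite  : Expr (idx N)
    `0 `∞      : Expr ext
    _`+_ _`-_  : Expr real → Expr real → Expr real
    `∣_∣       : Expr real → Expr real
    _`⊕_       : Expr ext → Expr real → Expr ext

  data Test : Set where
    _`≤_  : Expr real → Expr real → Test
    _`≤⁺_ : Expr ext → Expr ext → Test

  data Stmt : Set where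
    skip             : Stmt
    _⟨_,_⟩≔_         : (A : Fin k) → Expr (idx (rowsOf A)) → Expr (idx (colsOf A)) →
                       Expr (sortOf A) → Stmt
    _⨾_              : Stmt → Stmt → Stmt
    if_then_else_    : Test → Stmt → Stmt → Stmt
    for              : ∀ {n} → List (Fin n) → (Fin n → Stmt) → Stmt

  -- Number of nodes; every memory or input access, literal, arithmetic
  -- operation is one node.
  exprSize : ∀ {s} → Expr s → ℕ
  exprSize (at _)           = 1
  exprSize (A ⟨ r , c ⟩)    = 1 ℕ.+ exprSize r ℕ.+ exprSize c
  exprSize (siteAt e)       = 1 ℕ.+ exprSize e
  exprSize (arrivalAt e)    = 1 ℕ.+ exprSize e
  exprSize (locationOf _ _) = 1
  exprSize startSite        = 1
  exprSize `0               = 1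
  exprSize `∞               = 1
  exprSize (e `+ f)         = 1 ℕ.+ exprSize e ℕ.+ exprSize f
  exprSize (e `- f)         = 1 ℕ.+ exprSize e ℕ.+ exprSize f
  exprSize `∣ e ∣           = 1 ℕ.+ exprSize e
  exprSize (e `⊕ f)         = 1 ℕ.+ exprSize e ℕ.+ exprSize f

  testSize : Test → ℕ
  testSize (e `≤ f)  = 1 ℕ.+ exprSize e ℕ.+ exprSize f
  testSize (e `≤⁺ f) = 1 ℕ.+ exprSize e ℕ.+ exprSize f

  -- Storage used outside the arrays: one counter per enclosing loop, and at
  -- most one temporary per node of the expression being evaluated.
  auxiliary : Stmt → ℕ
  auxiliaryMax : ∀ {n} → List (Fin n) → (Fin n → Stmt) → ℕ
  auxiliary skip                   = 0
  auxiliary (A ⟨ r , c ⟩≔ e)       = exprSize r ℕ.+ exprSize c ℕ.+ exprSize e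
  auxiliary (s ⨾ s′)               = auxiliary s ℕ.⊔ auxiliary s′
  auxiliary (if b then s else s′)  = testSize b ℕ.⊔ (auxiliary s ℕ.⊔ auxiliary s′)
  auxiliary (for is s)             = 1 ℕ.+ auxiliaryMax is s
  auxiliaryMax []       s = 0
  auxiliaryMax (i ∷ is) s = auxiliary (s i) ℕ.⊔ auxiliaryMax is s

  space : Stmt → ℕ
  space s = Vec.sum (Vec.map (λ A → Array.rows A ℕ.* Array.cols A) layout) ℕ.+ auxiliary s

module Semantics {R : OrderedField} {S : Shape} (I : Input R S)
                 {k : ℕ} (layout : Vec Array k) where
  open OrderedField R
  open Shape S
  open Input I
  open Syntax S layout

  Val : Sort → Set
  Val real    = Carrier
  Val ext     = Carrier⁺
  Val (idx n) = Fin n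

  Store : Set
  Store = (A : Fin k) → Fin (rowsOf A) → Fin (colsOf A) → Val (sortOf A)

  write : Store → (A : Fin k) → Fin (rowsOf A) → Fin (colsOf A) → Val (sortOf A) → Store
  write μ A r c v B r′ c′ with A Fin.≟ B
  ... | no _ = μ B r′ c′
  ... | yes refl with (r Fin.≟ r′) ×-dec (c Fin.≟ c′)
  ...   | yes _ = v
  ...   | no  _ = μ A r′ c′

  ⟦_⟧ : ∀ {s} → Expr s → Store → Val s
  ⟦ at i ⟧           μ = i
  ⟦ A ⟨ r , c ⟩ ⟧    μ = μ A (⟦ r ⟧ μ) (⟦ c ⟧ μ)
  ⟦ siteAt e ⟧       μ = site (⟦ e ⟧ μ)
  ⟦ arrivalAt e ⟧    μ = arrival (⟦ e ⟧ μ)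
  ⟦ locationOf h i ⟧ μ = location h i
  ⟦ startSite ⟧      μ = s₀
  ⟦ `0 ⟧             μ = [ 0# ]
  ⟦ `∞ ⟧             μ = ⊤⁺
  ⟦ e `+ f ⟧         μ = ⟦ e ⟧ μ + ⟦ f ⟧ μ
  ⟦ e `- f ⟧         μ = ⟦ e ⟧ μ - ⟦ f ⟧ μ
  ⟦ `∣ e ∣ ⟧         μ = ∣ ⟦ e ⟧ μ ∣
  ⟦ e `⊕ f ⟧         μ = ⟦ e ⟧ μ ⊕ ⟦ f ⟧ μ

  Holds : Test → Store → Set
  Holds (e `≤ f)  μ = ⟦ e ⟧ μ ≤ ⟦ f ⟧ μ
  Holds (e `≤⁺ f) μ = ⟦ e ⟧ μ ≤⁺ ⟦ f ⟧ μ

  holds? : ∀ b μ → Dec (Holds b μ)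
  holds? (e `≤ f)  μ = ⟦ e ⟧ μ Order.≤? ⟦ f ⟧ μ
  holds? (e `≤⁺ f) μ = ⟦ e ⟧ μ Order⁺.≤? ⟦ f ⟧ μ

  exec : Stmt → Store → Store
  execFor : ∀ {n} → List (Fin n) → (Fin n → Stmt) → Store → Store
  exec skip                  μ = μ
  exec (A ⟨ r , c ⟩≔ e)      μ = write μ A (⟦ r ⟧ μ) (⟦ c ⟧ μ) (⟦ e ⟧ μ)
  exec (s ⨾ s′)              μ = exec s′ (exec s μ)
  exec (if b then s else s′) μ with holds? b μ
  ... | yes _ = exec s μ
  ... | no  _ = exec s′ μ
  exec (for is s)            μ = execFor is s μ
  execFor []       s μ = μ
  execFor (i ∷ is) s μ = execFor is s (exec (s i) μ)

  -- The number of steps performed by `exec`.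
  time : Stmt → Store → ℕ
  timeFor : ∀ {n} → List (Fin n) → (Fin n → Stmt) → Store → ℕ
  time skip                  μ = 1
  time (A ⟨ r , c ⟩≔ e)      μ = 1 ℕ.+ exprSize r ℕ.+ exprSize c ℕ.+ exprSize e
  time (s ⨾ s′)              μ = time s μ ℕ.+ time s′ (exec s μ)
  time (if b then s else s′) μ with holds? b μ
  ... | yes _ = testSize b ℕ.+ time s μ
  ... | no  _ = testSize b ℕ.+ time s′ μ
  time (for is s)            μ = timeFor is s μ
  timeFor []       s μ = 1
  timeFor (i ∷ is) s μ = 1 ℕ.+ time (s i) μ ℕ.+ timeFor is s (exec (s i) μ)

module DistanceTransform (S : Shape) where
  open Shape S

  layout : Vec Array 16
  layout =
      array ext     (suc m) N      -- 𝐅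
    ∷ array ext     (suc m) N      -- 𝐆
    ∷ array (idx N) (suc m) N      -- 𝐘
    ∷ array (idx m) m N            -- traceback: p
    ∷ array (idx N) m N            -- traceback: attaining predecessor
    ∷ array (idx 2) m N            -- traceback: winning term of the kernel
    ∷ array (idx N) 1 m            -- leftmost request site of each epoch
    ∷ array (idx N) 1 m            -- rightmost request site of each epoch
    ∷ array (idx N) 1 1            -- L, as a site
    ∷ array (idx N) 1 1            -- U, as a site
    ∷ array real    1 1            -- (U - L) + (a_j - a_p)
    ∷ array ext     1 1            -- scan: best value so far
    ∷ array (idx N) 1 1            -- scan: its minimizer
    ∷ array (idx N) 1 1            -- scan: site visited last
    ∷ array ext     1 1            -- candidate value
    ∷ array (idx 2) 1 1            -- candidate: winning term
    ∷ []

  open Syntax S layout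

  𝐅 𝐆 𝐘 ptrEpoch ptrState ptrTerm epochL epochU : Fin 16
  curL curU base best bestAt prev cand term : Fin 16
  𝐅        = Fin.# 0
  𝐆        = Fin.# 1
  𝐘        = Fin.# 2
  ptrEpoch = Fin.# 3
  ptrState = Fin.# 4
  ptrTerm  = Fin.# 5
  epochL   = Fin.# 6
  epochU   = Fin.# 7
  curL     = Fin.# 8
  curU     = Fin.# 9
  base     = Fin.# 10
  best     = Fin.# 11
  bestAt   = Fin.# 12
  prev     = Fin.# 13
  cand     = Fin.# 14
  term     = Fin.# 15

  o : Expr (idx 1)
  o = at zero

  lowSite highSite : Expr (idx N)
  lowSite  = curL ⟨ o , o ⟩
  highSite = curU ⟨ o , o ⟩

  epochExtrema : Stmt
  epochExtrema = for (allFin m) λ h →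
    epochL ⟨ o , at h ⟩≔ locationOf h (first h) ⨾
    epochU ⟨ o , at h ⟩≔ locationOf h (first h) ⨾
    for (allFin (size h)) λ i →
      (if siteAt (epochL ⟨ o , at h ⟩) `≤ siteAt (locationOf h i)
         then skip else (epochL ⟨ o , at h ⟩≔ locationOf h i)) ⨾
      (if siteAt (locationOf h i) `≤ siteAt (epochU ⟨ o , at h ⟩)
         then skip else (epochU ⟨ o , at h ⟩≔ locationOf h i))

  initialLayer : Stmt
  initialLayer =
    (for (allFin N) λ z → 𝐅 ⟨ at zero , at z ⟩≔ `∞) ⨾
    𝐅 ⟨ at zero , startSite ⟩≔ `0

  -- Before the first site of a scan `best` is ∞, so the values then held by
  -- `prev` and `bestAt` are irrelevant.
  resetScan : Stmt
  resetScan =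
    best   ⟨ o , o ⟩≔ `∞ ⨾
    bestAt ⟨ o , o ⟩≔ startSite ⨾
    prev   ⟨ o , o ⟩≔ startSite

  forwardScan backwardScan transform : Fin (suc m) → Stmt
  forwardScan h = resetScan ⨾ for (allFin N) λ x →
    best ⟨ o , o ⟩≔ best ⟨ o , o ⟩ `⊕ (siteAt (at x) `- siteAt (prev ⟨ o , o ⟩)) ⨾
    (if 𝐅 ⟨ at h , at x ⟩ `≤⁺ best ⟨ o , o ⟩
       then (best ⟨ o , o ⟩≔ 𝐅 ⟨ at h , at x ⟩ ⨾ bestAt ⟨ o , o ⟩≔ at x)
       else skip) ⨾
    𝐆 ⟨ at h , at x ⟩≔ best ⟨ o , o ⟩ ⨾
    𝐘 ⟨ at h , at x ⟩≔ bestAt ⟨ o , o ⟩ ⨾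
    prev ⟨ o , o ⟩≔ at x
  backwardScan h = resetScan ⨾ for (reverse (allFin N)) λ x →
    best ⟨ o , o ⟩≔ best ⟨ o , o ⟩ `⊕ (siteAt (prev ⟨ o , o ⟩) `- siteAt (at x)) ⨾
    (if 𝐆 ⟨ at h , at x ⟩ `≤⁺ best ⟨ o , o ⟩
       then (best ⟨ o , o ⟩≔ 𝐆 ⟨ at h , at x ⟩ ⨾ bestAt ⟨ o , o ⟩≔ 𝐘 ⟨ at h , at x ⟩)
       else skip) ⨾
    𝐆 ⟨ at h , at x ⟩≔ best ⟨ o , o ⟩ ⨾
    𝐘 ⟨ at h , at x ⟩≔ bestAt ⟨ o , o ⟩ ⨾
    prev ⟨ o , o ⟩≔ at x
  transform h = forwardScan h ⨾ backwardScan h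

  widen : Fin m → Stmt
  widen p =
    (if siteAt lowSite `≤ siteAt (epochL ⟨ o , at p ⟩)
       then skip else (curL ⟨ o , o ⟩≔ epochL ⟨ o , at p ⟩)) ⨾
    (if siteAt (epochU ⟨ o , at p ⟩) `≤ siteAt highSite
       then skip else (curU ⟨ o , o ⟩≔ epochU ⟨ o , at p ⟩))

  relax : (j p : Fin m) (z : Fin N) → Stmt
  relax j p z =
    (if leftFirst `≤⁺ rightFirst
       then (cand   ⟨ o , o ⟩≔ leftFirst ⨾
             bestAt ⟨ o , o ⟩≔ 𝐘 ⟨ at (inject₁ p) , lowSite ⟩ ⨾
             term   ⟨ o , o ⟩≔ at zero)
       else (cand   ⟨ o , o ⟩≔ rightFirst ⨾
             bestAt ⟨ o , o ⟩≔ 𝐘 ⟨ at (inject₁ p) , highSite ⟩ ⨾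
             term   ⟨ o , o ⟩≔ at (suc zero))) ⨾
    cand ⟨ o , o ⟩≔ cand ⟨ o , o ⟩ `⊕ base ⟨ o , o ⟩ ⨾
    (if 𝐅 ⟨ at (suc j) , at z ⟩ `≤⁺ cand ⟨ o , o ⟩
       then skip
       else (𝐅        ⟨ at (suc j) , at z ⟩≔ cand ⟨ o , o ⟩ ⨾
             ptrEpoch ⟨ at j , at z ⟩≔ at p ⨾
             ptrState ⟨ at j , at z ⟩≔ bestAt ⟨ o , o ⟩ ⨾
             ptrTerm  ⟨ at j , at z ⟩≔ term ⟨ o , o ⟩))
    where
    leftFirst rightFirst : Expr ext
    leftFirst  = 𝐆 ⟨ at (inject₁ p) , lowSite ⟩  `⊕ `∣ siteAt highSite `- siteAt (at z) ∣
    rightFirst = 𝐆 ⟨ at (inject₁ p) , highSite ⟩ `⊕ `∣ siteAt lowSite `- siteAt (at z) ∣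

  layer : Fin m → Stmt
  layer j =
    (for (allFin N) λ z → 𝐅 ⟨ at (suc j) , at z ⟩≔ `∞) ⨾
    curL ⟨ o , o ⟩≔ epochL ⟨ o , at j ⟩ ⨾
    curU ⟨ o , o ⟩≔ epochU ⟨ o , at j ⟩ ⨾
    (for (reverse (upTo j)) λ p →
       widen p ⨾
       base ⟨ o , o ⟩≔ (siteAt highSite `- siteAt lowSite)
                       `+ (arrivalAt (at j) `- arrivalAt (at p)) ⨾
       for (allFin N) (relax j p)) ⨾
    transform (suc j)

  program : Stmt
  program =
    epochExtrema ⨾
    initialLayer ⨾
    transform zero ⨾
    for (allFin m) layer

  workingSpace : ℕ
  workingSpace = space program

  module Run {R : OrderedField} (I : Input R S) where
    open Semantics I layout

    WorkingMemory : Set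
    WorkingMemory = Store

    result : WorkingMemory → Model.Table I
    result μ = exec program μ 𝐅

    runningTime : WorkingMemory → ℕ
    runningTime = time program

{-# OPTIONS --safe #-}
-- Optimality.  Call an arrival time a cut if no service event whose time is at
-- least that arrival serves an older request.  Between consecutive cuts p and
-- j + 1 the server visits every request of epochs p, …, j, so it walks at least
-- K p j between its end positions; and the waiting intervals [t − delay , t]
-- cover [a_p , a_j], because each arrival in between is straddled by one of
-- them, so at least a_j − a_p is paid in delay.  Hence the recurrence is a lower
-- bound.  Conversely each transition is realised by a single action at a_j that
-- serves epochs p, …, j during one sweep over [L , U].
--
-- Implementation.  Values are characterised as greatest lower bounds, a notion
-- stable under adding a constant; this gives G from the two scans and lets the
-- minimum over y in the recurrence be taken before j and z are known.
module Submission where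

open import Defs
open import Level using (0ℓ)
import Algebra.Construct.NaturalChoice.Max as NaturalMax
import Algebra.Construct.NaturalChoice.Min as NaturalMin
open import Algebra.Bundles using (AbelianGroup)
open import Algebra.Structures using (module IsCommutativeRing)
open import Data.Bool using (T)
open import Data.Fin as Fin using (Fin; zero; suc; toℕ; inject₁; fromℕ; fromℕ<)
import Data.Fin.Properties as Fin
open import Data.List
  using (List; []; _∷_; _++_; _ʳ++_; map; concatMap; filter; reverse; allFin; foldr; cartesianProduct;
         length; tabulate)
import Data.List.Extrema as Extrema
open import Data.List.Membership.Propositional using (_∈_; _∉_; find; lose)
open import Data.List.Membership.Propositional.Properties
  using (∈-map⁺; ∈-map⁻; ∈-filter⁺; ∈-filter⁻; ∈-allFin; ∈-concatMap⁺; ∈-concatMap⁻; ∈-++⁺ˡ; ∈-++⁺ʳ; ∈-++⁻;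
         ∈-cartesianProduct⁺; ∈-cartesianProduct⁻)
open import Data.List.Properties
  using (++-identityʳ; ++-assoc; concatMap-++; unfold-reverse; length-reverse; length-filter; length-tabulate)
open import Data.List.Relation.Unary.All as All using (All; []; _∷_)
import Data.List.Relation.Unary.All.Properties as All
open import Data.List.Relation.Unary.AllPairs as AllPairs using (AllPairs; []; _∷_)
import Data.List.Relation.Unary.AllPairs.Properties as AllPairs
open import Data.List.Relation.Unary.Any as Any using (Any; here; there)
import Data.List.Relation.Unary.Any.Properties as Any
open import Data.List.Relation.Unary.Linked using (Linked)
open import Data.List.Relation.Unary.Linked.Properties using (Linked⇒AllPairs; AllPairs⇒Linked)
import Data.Nat as ℕ
import Data.Nat.Properties as ℕ
open import Data.Nat using (ℕ; zero; suc)
open import Data.Product using (∃-syntax; _×_; _,_; proj₁; proj₂)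
open import Data.Sum as Sum using (_⊎_; inj₁; inj₂)
open import Data.Unit using (⊤; tt)
open import Data.Vec as Vec using (Vec; []; _∷_; lookup)
open import Function using (_∘_; _$_; flip; id)
open import Relation.Binary.Bundles using (TotalOrder)
open import Relation.Binary.Construct.Add.Supremum.NonStrict using ([_]; _≤⊤⁺)
open import Relation.Binary.PropositionalEquality
  using (_≡_; _≢_; refl; sym; trans; cong; cong₂; subst)
import Relation.Binary.Reasoning.PartialOrder as PosetReasoning
open import Relation.Nullary using (¬_; Dec; yes; no; contradiction)
open import Relation.Nullary.Construct.Add.Supremum using ([_]; ⊤⁺)
open import Relation.Nullary.Decidable using (_×-dec_)

-- Linear arithmetic

module AbelianGroupSolver {g ℓ} (G : AbelianGroup g ℓ) where
  open AbelianGroup G renaming (refl to ≈-refl; sym to ≈-sym; trans to ≈-trans)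
  open import Algebra.Properties.AbelianGroup G using (⁻¹-∙-comm; ⁻¹-involutive; ε⁻¹≈ε)
  open import Algebra.Properties.CommutativeSemigroup commutativeSemigroup using (interchange)
  open import Algebra.Properties.Monoid.Mult monoid using (×-homo-+) renaming (_×_ to _·_)
  open import Relation.Binary.Reasoning.Setoid setoid

  infixl 6 _:+_ _:-_
  infix  8 :-_

  data Expr (n : ℕ) : Set where
    var  : Fin n → Expr n
    :0   : Expr n
    _:+_ : Expr n → Expr n → Expr n
    :-_  : Expr n → Expr n

  _:-_ : ∀ {n} → Expr n → Expr n → Expr n
  e :- f = e :+ :- f

  ⟦_⟧ : ∀ {n} → Expr n → Vec Carrier n → Carrier
  ⟦ var i ⟧  ρ = lookup ρ i
  ⟦ :0 ⟧     ρ = ε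
  ⟦ e :+ f ⟧ ρ = ⟦ e ⟧ ρ ∙ ⟦ f ⟧ ρ
  ⟦ :- e ⟧   ρ = ⟦ e ⟧ ρ ⁻¹

  -- The pair (p , q) stands for the integer p − q; `reduced` makes it canonical.
  Coefficient : Set
  Coefficient = ℕ × ℕ

  reduced : Coefficient → Coefficient
  reduced (p , q) = p ℕ.∸ q , q ℕ.∸ p

  _·′_ : Coefficient → Carrier → Carrier
  (p , q) ·′ x = (p · x) ∙ (q · x) ⁻¹

  Normal : ℕ → Set
  Normal = Vec Coefficient

  zeroN : ∀ {n} → Normal n
  zeroN {zero}  = []
  zeroN {suc n} = (0 , 0) ∷ zeroN

  varN : ∀ {n} → Fin n → Normal n
  varN zero    = (1 , 0) ∷ zeroN
  varN (suc i) = (0 , 0) ∷ varN i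

  addN : ∀ {n} → Normal n → Normal n → Normal n
  addN []             []               = []
  addN ((p , q) ∷ cs) ((p′ , q′) ∷ ds) = reduced (p ℕ.+ p′ , q ℕ.+ q′) ∷ addN cs ds

  negN : ∀ {n} → Normal n → Normal n
  negN []             = []
  negN ((p , q) ∷ cs) = (q , p) ∷ negN cs

  normalise : ∀ {n} → Expr n → Normal n
  normalise (var i)  = varN i
  normalise :0       = zeroN
  normalise (e :+ f) = addN (normalise e) (normalise f)
  normalise (:- e)   = negN (normalise e)

  evalN : ∀ {n} → Normal n → Vec Carrier n → Carrier
  evalN []       []      = ε
  evalN (c ∷ cs) (x ∷ ρ) = c ·′ x ∙ evalN cs ρ

  ⟦_⇓⟧ : ∀ {n} → Expr n → Vec Carrier n → Carrier
  ⟦ e ⇓⟧ = evalN (normalise e)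

  reduced-sound : ∀ p q x → reduced (p , q) ·′ x ≈ (p , q) ·′ x
  reduced-sound zero    zero    x = ≈-refl
  reduced-sound zero    (suc q) x = ≈-refl
  reduced-sound (suc p) zero    x = ≈-refl
  reduced-sound (suc p) (suc q) x = begin
    reduced (p , q) ·′ x                       ≈⟨ reduced-sound p q x ⟩
    (p · x) ∙ (q · x) ⁻¹                       ≈⟨ identityˡ _ ⟨
    ε ∙ ((p · x) ∙ (q · x) ⁻¹)                 ≈⟨ ∙-congʳ (inverseʳ x) ⟨
    (x ∙ x ⁻¹) ∙ ((p · x) ∙ (q · x) ⁻¹)        ≈⟨ interchange x (x ⁻¹) (p · x) ((q · x) ⁻¹) ⟩
    (x ∙ (p · x)) ∙ (x ⁻¹ ∙ (q · x) ⁻¹)        ≈⟨ ∙-congˡ (⁻¹-∙-comm x (q · x)) ⟩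
    (x ∙ (p · x)) ∙ (x ∙ (q · x)) ⁻¹           ∎

  ·′-homo-+ : ∀ p q p′ q′ x → (p ℕ.+ p′ , q ℕ.+ q′) ·′ x ≈ (p , q) ·′ x ∙ (p′ , q′) ·′ x
  ·′-homo-+ p q p′ q′ x = begin
    ((p ℕ.+ p′) · x) ∙ ((q ℕ.+ q′) · x) ⁻¹
      ≈⟨ ∙-cong (×-homo-+ x p p′) (⁻¹-cong (×-homo-+ x q q′)) ⟩
    (p · x ∙ p′ · x) ∙ (q · x ∙ q′ · x) ⁻¹
      ≈⟨ ∙-congˡ (⁻¹-∙-comm (q · x) (q′ · x)) ⟨
    (p · x ∙ p′ · x) ∙ ((q · x) ⁻¹ ∙ (q′ · x) ⁻¹)
      ≈⟨ interchange _ _ _ _ ⟩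
    (p , q) ·′ x ∙ (p′ , q′) ·′ x ∎

  zero-sound : ∀ {n} (ρ : Vec Carrier n) → evalN zeroN ρ ≈ ε
  zero-sound []      = ≈-refl
  zero-sound (x ∷ ρ) = ≈-trans (∙-cong (inverseʳ ε) (zero-sound ρ)) (identityˡ ε)

  var-sound : ∀ {n} (i : Fin n) ρ → evalN (varN i) ρ ≈ lookup ρ i
  var-sound zero (x ∷ ρ) = begin
    ((x ∙ ε) ∙ ε ⁻¹) ∙ evalN zeroN ρ ≈⟨ ∙-cong (∙-cong (identityʳ x) ε⁻¹≈ε) (zero-sound ρ) ⟩
    (x ∙ ε) ∙ ε                      ≈⟨ identityʳ _ ⟩
    x ∙ ε                            ≈⟨ identityʳ x ⟩
    x                                ∎
  var-sound (suc i) (x ∷ ρ) = ≈-trans (∙-cong (inverseʳ ε) (var-sound i ρ)) (identityˡ _)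

  add-sound : ∀ {n} (cs ds : Normal n) ρ → evalN (addN cs ds) ρ ≈ evalN cs ρ ∙ evalN ds ρ
  add-sound []             []               []      = ≈-sym (identityˡ ε)
  add-sound ((p , q) ∷ cs) ((p′ , q′) ∷ ds) (x ∷ ρ) = begin
    reduced (p ℕ.+ p′ , q ℕ.+ q′) ·′ x ∙ evalN (addN cs ds) ρ
      ≈⟨ ∙-cong (≈-trans (reduced-sound (p ℕ.+ p′) (q ℕ.+ q′) x) (·′-homo-+ p q p′ q′ x))
                (add-sound cs ds ρ) ⟩
    ((p , q) ·′ x ∙ (p′ , q′) ·′ x) ∙ (evalN cs ρ ∙ evalN ds ρ)
      ≈⟨ interchange _ _ _ _ ⟩
    ((p , q) ·′ x ∙ evalN cs ρ) ∙ ((p′ , q′) ·′ x ∙ evalN ds ρ) ∎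

  neg-sound : ∀ {n} (cs : Normal n) ρ → evalN (negN cs) ρ ≈ evalN cs ρ ⁻¹
  neg-sound []             []      = ≈-sym ε⁻¹≈ε
  neg-sound ((p , q) ∷ cs) (x ∷ ρ) = begin
    (q , p) ·′ x ∙ evalN (negN cs) ρ                       ≈⟨ ∙-cong (comm _ _) (neg-sound cs ρ) ⟩
    ((p · x) ⁻¹ ∙ (q · x)) ∙ evalN cs ρ ⁻¹                 ≈⟨ ∙-congʳ (∙-congˡ (⁻¹-involutive (q · x))) ⟨
    ((p · x) ⁻¹ ∙ (q · x) ⁻¹ ⁻¹) ∙ evalN cs ρ ⁻¹           ≈⟨ ∙-congʳ (⁻¹-∙-comm (p · x) ((q · x) ⁻¹)) ⟩
    ((p , q) ·′ x) ⁻¹ ∙ evalN cs ρ ⁻¹                      ≈⟨ ⁻¹-∙-comm _ _ ⟩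
    ((p , q) ·′ x ∙ evalN cs ρ) ⁻¹                         ∎

  sound : ∀ {n} (e : Expr n) ρ → ⟦ e ⇓⟧ ρ ≈ ⟦ e ⟧ ρ
  sound (var i)  ρ = var-sound i ρ
  sound :0       ρ = zero-sound ρ
  sound (e :+ f) ρ = ≈-trans (add-sound (normalise e) (normalise f) ρ) (∙-cong (sound e ρ) (sound f ρ))
  sound (:- e)   ρ = ≈-trans (neg-sound (normalise e) ρ) (⁻¹-cong (sound e ρ))

  open import Relation.Binary.Reflection setoid var ⟦_⟧ ⟦_⇓⟧ sound public using (solve; _⊜_)

module OrderedFieldProperties (R : OrderedField) where
  open OrderedField R

  +-abelianGroup : AbelianGroup 0ℓ 0ℓ
  +-abelianGroup = record
    { isAbelianGroup = IsCommutativeRing.+-isAbelianGroup isCommutativeRing }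

  open AbelianGroup +-abelianGroup public using ()
    renaming (identityˡ to +-identityˡ; identityʳ to +-identityʳ; assoc to +-assoc; comm to +-comm)
  open AbelianGroupSolver +-abelianGroup public

  open Order public using ()
    renaming (refl to ≤-refl; reflexive to ≤-reflexive; trans to ≤-trans; antisym to ≤-antisym;
              total to ≤-total)
  open NaturalMin totalOrder public using (x⊓y≤x; x⊓y≤y; ⊓-glb)
  open NaturalMax totalOrder public using (x≤x⊔y; x≤y⊔x; ⊔-lub)
  module ≤-Reasoning = PosetReasoning (TotalOrder.poset totalOrder)

  +-mono-≤ : ∀ {x y u v} → x ≤ y → u ≤ v → x + u ≤ y + v
  +-mono-≤ {x} {y} {u} {v} x≤y u≤v = begin
    x + u ≤⟨ +-monoʳ-≤ x u≤v ⟩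
    x + v ≡⟨ +-comm x v ⟩
    v + x ≤⟨ +-monoʳ-≤ v x≤y ⟩
    v + y ≡⟨ +-comm v y ⟩
    y + v ∎
    where open ≤-Reasoning

  -- Any linear consequence of l ≤ h: the equation is left to the solver.
  ≤-by : ∀ {l h x y} → l ≤ h → x + h ≡ l + y → x ≤ y
  ≤-by {l} {h} {x} {y} l≤h eq = begin
    x             ≡⟨ solve 2 (λ x h → x ⊜ x :+ h :- h) refl x h ⟩
    x + h - h     ≡⟨ cong (_- h) eq ⟩
    l + y - h     ≤⟨ +-mono-≤ (+-mono-≤ l≤h ≤-refl) ≤-refl ⟩
    h + y - h     ≡⟨ solve 2 (λ h y → h :+ y :- h ⊜ y) refl h y ⟩
    y             ∎
    where open ≤-Reasoning

  x≤∣x∣ : ∀ x → x ≤ ∣ x ∣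
  x≤∣x∣ x = x≤x⊔y x (- x)

  -x≤∣x∣ : ∀ x → - x ≤ ∣ x ∣
  -x≤∣x∣ x = x≤y⊔x x (- x)

  ∣∣-least : ∀ {x c} → x ≤ c → - x ≤ c → ∣ x ∣ ≤ c
  ∣∣-least = ⊔-lub

  0≤∣x∣ : ∀ x → 0# ≤ ∣ x ∣
  0≤∣x∣ x with ≤-total 0# x
  ... | inj₁ 0≤x = ≤-trans 0≤x (x≤∣x∣ x)
  ... | inj₂ x≤0 = ≤-trans (≤-by x≤0 (solve 1 (λ x → :0 :+ :0 ⊜ x :- x) refl x)) (-x≤∣x∣ x)

  ∣x-y∣-sym-≤ : ∀ x y → ∣ x - y ∣ ≤ ∣ y - x ∣
  ∣x-y∣-sym-≤ x y = ∣∣-least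
    (≤-trans (≤-reflexive (solve 2 (λ x y → x :- y ⊜ :- (y :- x)) refl x y)) (-x≤∣x∣ (y - x)))
    (≤-trans (≤-reflexive (solve 2 (λ x y → :- (x :- y) ⊜ y :- x) refl x y)) (x≤∣x∣ (y - x)))

  ∣x-y∣-sym : ∀ x y → ∣ x - y ∣ ≡ ∣ y - x ∣
  ∣x-y∣-sym x y = ≤-antisym (∣x-y∣-sym-≤ x y) (∣x-y∣-sym-≤ y x)

  ∣x-z∣-triangle : ∀ x y z → ∣ x - z ∣ ≤ ∣ x - y ∣ + ∣ y - z ∣
  ∣x-z∣-triangle x y z = ∣∣-least
    (≤-trans (≤-reflexive (solve 3 (λ x y z → x :- z ⊜ (x :- y) :+ (y :- z)) refl x y z))
             (+-mono-≤ (x≤∣x∣ (x - y)) (x≤∣x∣ (y - z))))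
    (≤-trans (≤-reflexive (solve 3 (λ x y z → :- (x :- z) ⊜ :- (x :- y) :+ :- (y :- z)) refl x y z))
             (+-mono-≤ (-x≤∣x∣ (x - y)) (-x≤∣x∣ (y - z))))

  x≤y⇒0≤y-x : ∀ {x y} → x ≤ y → 0# ≤ y - x
  x≤y⇒0≤y-x {x} {y} x≤y = ≤-by x≤y (solve 2 (λ x y → :0 :+ y ⊜ x :+ (y :- x)) refl x y)

  x≤y⇒∣x-y∣≡y-x : ∀ {x y} → x ≤ y → ∣ x - y ∣ ≡ y - x
  x≤y⇒∣x-y∣≡y-x {x} {y} x≤y = ≤-antisym
    (∣∣-least
      (≤-by (+-mono-≤ x≤y x≤y)
        (solve 2 (λ x y → (x :- y) :+ (y :+ y) ⊜ (x :+ x) :+ (y :- x)) refl x y))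
      (≤-reflexive (solve 2 (λ x y → :- (x :- y) ⊜ y :- x) refl x y)))
    (≤-trans (≤-reflexive (solve 2 (λ x y → y :- x ⊜ :- (x :- y)) refl x y)) (-x≤∣x∣ (x - y)))

  ∣x-x∣≡0 : ∀ x → ∣ x - x ∣ ≡ 0#
  ∣x-x∣≡0 x = trans (x≤y⇒∣x-y∣≡y-x ≤-refl) (solve 1 (λ x → x :- x ⊜ :0) refl x)

  open Order⁺ public using ()
    renaming (refl to ≤⁺-refl; reflexive to ≤⁺-reflexive; trans to ≤⁺-trans;
              antisym to ≤⁺-antisym; total to ≤⁺-total)

  ⊕-mono-≤ : ∀ {u v c e} → u ≤⁺ v → c ≤ e → u ⊕ c ≤⁺ v ⊕ e
  ⊕-mono-≤ [ u≤v ]    c≤e = [ +-mono-≤ u≤v c≤e ]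
  ⊕-mono-≤ (_ ≤⊤⁺) c≤e = _ ≤⊤⁺

  ⊕-assoc : ∀ u c e → u ⊕ c ⊕ e ≡ u ⊕ (c + e)
  ⊕-assoc [ x ] c e = cong [_] (+-assoc x c e)
  ⊕-assoc ⊤⁺    c e = refl

  ⊕-cancel : ∀ u c → u ⊕ c ⊕ (- c) ≡ u
  ⊕-cancel [ x ] c = cong [_] (solve 2 (λ x c → x :+ c :- c ⊜ x) refl x c)
  ⊕-cancel ⊤⁺    c = refl

  ⊕-cancel′ : ∀ u c → u ⊕ (- c) ⊕ c ≡ u
  ⊕-cancel′ [ x ] c = cong [_] (solve 2 (λ x c → x :- c :+ c ⊜ x) refl x c)
  ⊕-cancel′ ⊤⁺    c = refl

  ⊕-identity : ∀ u → u ⊕ 0# ≡ u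
  ⊕-identity [ x ] = cong [_] (+-identityʳ x)
  ⊕-identity ⊤⁺    = refl

  -- The infimum over an empty P is ⊤⁺.
  IsGlb : {A : Set} → (A → Set) → (A → Carrier⁺) → Carrier⁺ → Set
  IsGlb P f v = (∀ {x} → P x → v ≤⁺ f x) × (∀ b → (∀ {x} → P x → b ≤⁺ f x) → b ≤⁺ v)

  glb-unique : ∀ {A : Set} {P : A → Set} {f u v} → IsGlb P f u → IsGlb P f v → u ≡ v
  glb-unique (u≤f , f≤u) (v≤f , f≤v) = ≤⁺-antisym (f≤v _ u≤f) (f≤u _ v≤f)

  glb-⊕ : ∀ {A : Set} {P : A → Set} {f v} c → IsGlb P f v → IsGlb P (λ x → f x ⊕ c) (v ⊕ c)
  glb-⊕ {f = f} {v} c (v≤f , f≤v) =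
    (λ Px → ⊕-mono-≤ (v≤f Px) ≤-refl) ,
    λ b b≤f → subst (_≤⁺ v ⊕ c) (⊕-cancel′ b c)
      (⊕-mono-≤ (f≤v (b ⊕ (- c)) λ {x} Px →
        subst (b ⊕ (- c) ≤⁺_) (⊕-cancel (f x) c) (⊕-mono-≤ (b≤f Px) ≤-refl)) ≤-refl)

  glb-resp : ∀ {A : Set} {P P′ : A → Set} {f g v} → (∀ {x} → P x → P′ x) → (∀ {x} → P′ x → P x) →
             (∀ {x} → P x → f x ≡ g x) → IsGlb P f v → IsGlb P′ g v
  glb-resp P⊆P′ P′⊆P f≡g (v≤f , f≤v) =
    (λ P′x → subst (_ ≤⁺_) (f≡g (P′⊆P P′x)) (v≤f (P′⊆P P′x))) ,
    λ b b≤g → f≤v b λ Px → subst (b ≤⁺_) (sym (f≡g Px)) (b≤g (P⊆P′ Px))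

  module Extrema⁺ = Extrema totalOrder⁺

  minimum-glb : ∀ {A : Set} (xs : List A) f → IsGlb (_∈ xs) f (minimum xs f)
  minimum-glb xs f =
    (λ x∈xs → All.lookup (Extrema⁺.min≤xs ⊤⁺ (map f xs)) (∈-map⁺ f x∈xs)) ,
    λ b b≤f → Extrema⁺.v≤min⁺ (b ≤⊤⁺) (All.map⁺ (All.tabulate b≤f))

  minimum-attained : ∀ {A : Set} (xs : List A) f {c} → minimum xs f ≤⁺ [ c ] →
                     ∃[ x ] x ∈ xs × f x ≤⁺ [ c ]
  minimum-attained xs f {c} min≤c
    with Extrema.argmin-sel totalOrder⁺ (λ v → v) ⊤⁺ (map f xs)
  ... | inj₁ eq = contra (subst (_≤⁺ [ c ]) eq min≤c)
    where contra : ∀ {A : Set} → ⊤⁺ ≤⁺ [ c ] → A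
          contra ()
  ... | inj₂ min∈ with ∈-map⁻ f min∈
  ...   | x , x∈xs , eq = x , x∈xs , subst (_≤⁺ [ c ]) eq min≤c

  module Extrema₀ = Extrema totalOrder

  min-attained : ∀ {A : Set} (f : A → Carrier) {x} {xs : List A} → x ∈ xs →
                 ∃[ y ] y ∈ xs × min (f x) (map f xs) ≡ f y
  min-attained f {x} {xs} x∈xs with Extrema.argmin-sel totalOrder (λ v → v) (f x) (map f xs)
  ... | inj₁ eq   = x , x∈xs , eq
  ... | inj₂ min∈ = ∈-map⁻ f min∈

  max-attained : ∀ {A : Set} (f : A → Carrier) {x} {xs : List A} → x ∈ xs →
                 ∃[ y ] y ∈ xs × max (f x) (map f xs) ≡ f y
  max-attained f {x} {xs} x∈xs with Extrema.argmax-sel totalOrder (λ v → v) (f x) (map f xs)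
  ... | inj₁ eq   = x , x∈xs , eq
  ... | inj₂ max∈ = ∈-map⁻ f max∈

  min-≤ : ∀ {A : Set} (f : A → Carrier) v {xs : List A} {y} → y ∈ xs → min v (map f xs) ≤ f y
  min-≤ f v {xs} y∈xs = All.lookup (Extrema₀.min≤xs v (map f xs)) (∈-map⁺ f y∈xs)

  ≤-max : ∀ {A : Set} (f : A → Carrier) v {xs : List A} {y} → y ∈ xs → f y ≤ max v (map f xs)
  ≤-max f v {xs} y∈xs = All.lookup (Extrema₀.xs≤max v (map f xs)) (∈-map⁺ f y∈xs)

-- Optimality of the recurrence

module Kernel {R : OrderedField} {S : Shape} (I : Input R S) where
  open OrderedField R
  open OrderedFieldProperties R
  open Shape S
  open Input I
  open Model I

  InRange : Fin m → Fin m → Request → Set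
  InRange p j q = p Fin.≤ proj₁ q × proj₁ q Fin.≤ j

  ∈-requests⁺ : ∀ {p j q} → InRange p j q → q ∈ requests p j
  ∈-requests⁺ {p} {j} {h , i} (p≤h , h≤j) = ∈-concatMap⁺ _
    (lose (∈-filter⁺ (λ h → (p Fin.≤? h) ×-dec (h Fin.≤? j)) (∈-allFin h) (p≤h , h≤j))
          (∈-map⁺ (h ,_) (∈-allFin i)))

  ∈-requests⁻ : ∀ {p j q} → q ∈ requests p j → InRange p j q
  ∈-requests⁻ {p} {j} {q} q∈
    with find (∈-concatMap⁻ (λ h → map (h ,_) (allFin (size h))) {xs = range p j} q∈)
  ... | h , h∈ , q∈h with ∈-map⁻ (h ,_) q∈h
  ...   | i , _ , refl =
    proj₂ (∈-filter⁻ (λ h → (p Fin.≤? h) ×-dec (h Fin.≤? j)) {xs = allFin m} h∈)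

  first∈requests : ∀ {p j} → p Fin.≤ j → (p , first p) ∈ requests p j
  first∈requests p≤j = ∈-requests⁺ (Fin.≤-refl , p≤j)

  siteOf : Request → Carrier
  siteOf q = site (loc q)

  L-≤ : ∀ {p j q} → InRange p j q → L p j ≤ siteOf q
  L-≤ r = min-≤ siteOf _ (∈-requests⁺ r)

  ≤-U : ∀ {p j q} → InRange p j q → siteOf q ≤ U p j
  ≤-U r = ≤-max siteOf _ (∈-requests⁺ r)

  L-attained : ∀ {p j} → p Fin.≤ j → ∃[ q ] InRange p j q × L p j ≡ siteOf q
  L-attained p≤j with min-attained siteOf (first∈requests p≤j)
  ... | q , q∈ , eq = q , ∈-requests⁻ q∈ , eq

  U-attained : ∀ {p j} → p Fin.≤ j → ∃[ q ] InRange p j q × U p j ≡ siteOf q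
  U-attained p≤j with max-attained siteOf (first∈requests p≤j)
  ... | q , q∈ , eq = q , ∈-requests⁻ q∈ , eq

  d-triangle : ∀ x y z → d x z ≤ d x y + d y z
  d-triangle x y z = ∣x-z∣-triangle (site x) (site y) (site z)

  d-refl : ∀ x → d x x ≡ 0#
  d-refl x = ∣x-x∣≡0 (site x)

  0≤lengthFrom : ∀ y ws → 0# ≤ lengthFrom y ws
  0≤lengthFrom y []       = ≤-refl
  0≤lengthFrom y (w ∷ ws) = ≤-trans (≤-reflexive (sym (+-identityʳ 0#)))
                                    (+-mono-≤ (0≤∣x∣ (site y - site w)) (0≤lengthFrom w ws))

  d-end-≤-length : ∀ y ws → d y (endFrom y ws) ≤ lengthFrom y ws
  d-end-≤-length y []       = ≤-reflexive (d-refl y)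
  d-end-≤-length y (w ∷ ws) =
    ≤-trans (d-triangle y w (endFrom w ws)) (+-mono-≤ ≤-refl (d-end-≤-length w ws))

  through-≤-length : ∀ y ws {v} → v ∈ y ∷ ws → d y v + d v (endFrom y ws) ≤ lengthFrom y ws
  through-≤-length y ws (here refl) = ≤-trans
    (≤-reflexive (trans (cong (_+ d y (endFrom y ws)) (d-refl y)) (+-identityˡ _)))
    (d-end-≤-length y ws)
  through-≤-length y (w ∷ ws) {v} (there v∈) = begin
    d y v + d v e             ≤⟨ +-mono-≤ (d-triangle y w v) ≤-refl ⟩
    (d y w + d w v) + d v e   ≡⟨ +-assoc _ _ _ ⟩
    d y w + (d w v + d v e)   ≤⟨ +-mono-≤ ≤-refl (through-≤-length w ws v∈) ⟩
    d y w + lengthFrom w ws   ∎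
    where open ≤-Reasoning
          e = endFrom w ws

  prepend-step : ∀ y w u {g e l} → g + (d w u + e) ≤ l → g + (d y u + e) ≤ d y w + l
  prepend-step y w u {g} {e} {l} le = ≤-by (+-mono-≤ le (d-triangle y w u))
    (solve 6 (λ g yu yw wu e l → (g :+ (yu :+ e)) :+ (l :+ (yw :+ wu)) ⊜
                                 (g :+ (wu :+ e)) :+ yu :+ (yw :+ l))
             refl g (d y u) (d y w) (d w u) e l)

  through₂-≤-length : ∀ y ws {u v} → u ∈ y ∷ ws → v ∈ y ∷ ws →
    d u v + (d y u + d v (endFrom y ws)) ≤ lengthFrom y ws ⊎
    d v u + (d y v + d u (endFrom y ws)) ≤ lengthFrom y ws
  through₂-≤-length y ws {v = v} (here refl) v∈ = inj₁ (≤-trans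
    (≤-reflexive (cong (d y v +_) (trans (cong (_+ d v (endFrom y ws)) (d-refl y)) (+-identityˡ _))))
    (through-≤-length y ws v∈))
  through₂-≤-length y ws {u} (there u∈) (here refl) = inj₂ (≤-trans
    (≤-reflexive (cong (d y u +_) (trans (cong (_+ d u (endFrom y ws)) (d-refl y)) (+-identityˡ _))))
    (through-≤-length y ws (there u∈)))
  through₂-≤-length y (w ∷ ws) {u} {v} (there u∈) (there v∈) =
    Sum.map (prepend-step y w u) (prepend-step y w v) (through₂-≤-length w ws u∈ v∈)

  K-≤-length : ∀ {p j} y ws → p Fin.≤ j →
    (∀ {q} → InRange p j q → loc q ∈ y ∷ ws) → K p j y (endFrom y ws) ≤ lengthFrom y ws
  K-≤-length {p} {j} y ws p≤j visited with L-attained p≤j | U-attained p≤j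
  ... | l , l∈ , L≡ | u , u∈ , U≡ =
    Sum.[ left-first , right-first ]′ (through₂-≤-length y ws (visited l∈) (visited u∈))
    where
    z = endFrom y ws

    width : U p j - L p j ≤ d (loc u) (loc l)
    width = ≤-trans (x≤∣x∣ _) (≤-reflexive (cong₂ (λ a b → ∣ a - b ∣) U≡ L≡))

    left-first : d (loc l) (loc u) + (d y (loc l) + d (loc u) z) ≤ lengthFrom y ws →
                 K p j y z ≤ lengthFrom y ws
    left-first = ≤-trans (+-mono-≤ (≤-trans width (∣x-y∣-sym-≤ (siteOf u) (siteOf l)))
      (≤-trans (x⊓y≤x _ _) (≤-reflexive (cong₂ (λ a b → ∣ site y - a ∣ + ∣ b - site z ∣) L≡ U≡))))

    right-first : d (loc u) (loc l) + (d y (loc u) + d (loc l) z) ≤ lengthFrom y ws →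
                  K p j y z ≤ lengthFrom y ws
    right-first = ≤-trans (+-mono-≤ width
      (≤-trans (x⊓y≤y (∣ site y - L p j ∣ + ∣ U p j - site z ∣) _)
               (≤-reflexive (cong₂ (λ a b → ∣ site y - a ∣ + ∣ b - site z ∣) U≡ L≡))))

module Schedules {R : OrderedField} {S : Shape} (I : Input R S) where
  open OrderedField R
  open OrderedFieldProperties R
  open Shape S
  open Input I
  open Model I
  open Kernel I

  TimedEvent : Set
  TimedEvent = Carrier × Event

  walkOf : TimedEvent → Walk
  walkOf (_ , e) = Event.walk e

  servedBy : TimedEvent → List Request
  servedBy (_ , e) = Event.served e

  delayOf : TimedEvent → Carrier
  delayOf (t , e) = delay t (Event.served e)

  total : (TimedEvent → Carrier) → List TimedEvent → Carrier
  total f = foldr (λ e c → f e + c) 0#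

  total-++ : ∀ f es fs → total f (es ++ fs) ≡ total f es + total f fs
  total-++ f []       fs = sym (+-identityˡ _)
  total-++ f (e ∷ es) fs = trans (cong (f e +_) (total-++ f es fs)) (sym (+-assoc _ _ _))

  total-+ : ∀ f g es → total f es + total g es ≡ total (λ e → f e + g e) es
  total-+ f g []       = +-identityˡ 0#
  total-+ f g (e ∷ es) = trans
    (solve 4 (λ a b c e → (a :+ b) :+ (c :+ e) ⊜ (a :+ c) :+ (b :+ e)) refl
             (f e) (total f es) (g e) (total g es))
    (cong ((f e + g e) +_) (total-+ f g es))

  total-mono : ∀ {f g} es → All (λ e → f e ≤ g e) es → total f es ≤ total g es
  total-mono []       []           = ≤-refl
  total-mono (e ∷ es) (f≤g ∷ f≤gs) = +-mono-≤ f≤g (total-mono es f≤gs)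

  total-mono-gap : ∀ {f g c} es → All (λ e → f e ≤ g e) es → Any (λ e → f e + c ≤ g e) es →
                   total f es + c ≤ total g es
  total-mono-gap {f} {g} {c} (e ∷ es) (f≤g ∷ f≤gs) (here gap) =
    ≤-trans (≤-reflexive (solve 3 (λ a b c → a :+ b :+ c ⊜ (a :+ c) :+ b) refl (f e) (total f es) c))
            (+-mono-≤ gap (total-mono es f≤gs))
  total-mono-gap {f} {g} {c} (e ∷ es) (f≤g ∷ f≤gs) (there gap) =
    ≤-trans (≤-reflexive (+-assoc _ _ _)) (+-mono-≤ f≤g (total-mono-gap es f≤gs gap))

  total-nonNeg : ∀ f es → All (λ e → 0# ≤ f e) es → 0# ≤ total f es
  total-nonNeg f []       []         = ≤-refl
  total-nonNeg f (e ∷ es) (0≤ ∷ 0≤s) =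
    ≤-trans (≤-reflexive (sym (+-identityˡ 0#))) (+-mono-≤ 0≤ (total-nonNeg f es 0≤s))

  arrival-mono-≤ : ∀ {h k} → h Fin.≤ k → arrival h ≤ arrival k
  arrival-mono-≤ {h} {k} h≤k with h Fin.≟ k
  ... | yes refl = ≤-refl
  ... | no  h≢k  = proj₁ (arrival-mono (Fin.≤∧≢⇒< h≤k h≢k))

  path : List TimedEvent → List (Fin N)
  path = concatMap (Walk.steps ∘ walkOf)

  endAfter : Fin N → List TimedEvent → Fin N
  endAfter y es = endFrom y (path es)

  endFrom-++ : ∀ y vs ws → endFrom y (vs ++ ws) ≡ endFrom (endFrom y vs) ws
  endFrom-++ y []       ws = refl
  endFrom-++ y (v ∷ vs) ws = endFrom-++ v vs ws

  lengthFrom-++ : ∀ y vs ws → lengthFrom y (vs ++ ws) ≡ lengthFrom y vs + lengthFrom (endFrom y vs) ws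
  lengthFrom-++ y []       ws = sym (+-identityˡ _)
  lengthFrom-++ y (v ∷ vs) ws = trans (cong (d y v +_) (lengthFrom-++ v vs ws)) (sym (+-assoc _ _ _))

  endAfter-++ : ∀ y es fs → endAfter y (es ++ fs) ≡ endAfter (endAfter y es) fs
  endAfter-++ y es fs = trans (cong (endFrom y) (concatMap-++ _ es fs)) (endFrom-++ y (path es) (path fs))

  connected-++⁻ : ∀ {y} es {fs} → Connected y (es ++ fs) →
                  Connected y es × Connected (endAfter y es) fs
  connected-++⁻ []       c          = _ , c
  connected-++⁻ ((_ , record { walk = w then vs }) ∷ es) {fs} (refl , c) with connected-++⁻ es c
  ... | c₁ , c₂ = (refl , c₁) ,
    subst (λ z → Connected z fs) (sym (endFrom-++ w vs (path es))) c₂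

  connected-++⁺ : ∀ {y} es {fs} → Connected y es → Connected (endAfter y es) fs → Connected y (es ++ fs)
  connected-++⁺ []       _          c = c
  connected-++⁺ ((_ , record { walk = w then vs }) ∷ es) {fs} (refl , c) c′ =
    refl , connected-++⁺ es c (subst (λ z → Connected z fs) (endFrom-++ w vs (path es)) c′)

  total-len : ∀ {y} es → Connected y es → total (len ∘ walkOf) es ≡ lengthFrom y (path es)
  total-len []       _          = refl
  total-len ((_ , record { walk = w then vs }) ∷ es) (refl , c) =
    trans (cong (lengthFrom w vs +_) (total-len es c)) (sym (lengthFrom-++ w vs (path es)))

  end∈ : ∀ y vs → endFrom y vs ∈ y ∷ vs
  end∈ y []       = here refl
  end∈ y (v ∷ vs) = there (end∈ v vs)

  vertices⊆path : ∀ {y} es {e v} → Connected y es → e ∈ es → v ∈ vertices (walkOf e) → v ∈ y ∷ path es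
  vertices⊆path ((_ , record { walk = w then vs }) ∷ es) (refl , c) (here refl) v∈ =
    ∈-++⁺ˡ {xs = w ∷ vs} v∈
  vertices⊆path ((_ , record { walk = w then vs }) ∷ es) (refl , c) (there e∈) v∈
    with vertices⊆path es c e∈ v∈
  ... | here refl = ∈-++⁺ˡ {xs = w ∷ vs} (end∈ w vs)
  ... | there v∈′ = ∈-++⁺ʳ (w ∷ vs) v∈′

  Served : TimedEvent → Request → Set
  Served (t , e) q = a q ≤ t × loc q ∈ vertices (Event.walk e)

  elective⇒served : ∀ {D} es → Elective D es → All (λ e → All (Served e) (servedBy e)) es
  elective⇒served []       _        = []
  elective⇒served (e ∷ es) (h , hs) = All.map (λ (a≤t , _ , v∈) → a≤t , v∈) h ∷ elective⇒served es hs

  delay-≥ : ∀ t {q B} → q ∈ B → t - a q ≤ delay t B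
  delay-≥ t {B = q ∷ qs} (here refl) = Extrema₀.⊥≤max (t - a q) (map (λ r → t - a r) qs)
  delay-≥ t {B = q ∷ qs} (there q∈)  = ≤-max (λ r → t - a r) (t - a q) q∈

  delay-≤ : ∀ t {c} B → 0# ≤ c → All (λ q → t - a q ≤ c) B → delay t B ≤ c
  delay-≤ t []       0≤c _          = 0≤c
  delay-≤ t (q ∷ qs) 0≤c (h ∷ hs) = Extrema₀.max≤v⁺ h (All.map⁺ hs)

  delay-nonNeg : ∀ t B → All (λ q → a q ≤ t) B → 0# ≤ delay t B
  delay-nonNeg t []       _       = ≤-refl
  delay-nonNeg t (q ∷ qs) (h ∷ _) = ≤-trans (x≤y⇒0≤y-x h) (delay-≥ t {B = q ∷ qs} (here refl))

  -- How much of the waiting interval [t − delay , t] of an event lies before x.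
  clip : Carrier → TimedEvent → Carrier
  clip x e@(t , _) = 0# ⊔ ((t ⊓ x) - (t - delayOf e))

  clip-mono : ∀ {x y} e → x ≤ y → clip x e ≤ clip y e
  clip-mono {x} {y} e@(t , _) x≤y = ⊔-lub (x≤x⊔y _ _)
    (≤-trans (+-mono-≤ (⊓-glb (x⊓y≤x t x) (≤-trans (x⊓y≤y t x) x≤y)) ≤-refl) (x≤y⊔x 0# _))

  clip-≤-delay : ∀ x e → 0# ≤ delayOf e → clip x e ≤ delayOf e
  clip-≤-delay x e@(t , _) 0≤δ = ⊔-lub 0≤δ
    (≤-trans (+-mono-≤ (x⊓y≤x t x) ≤-refl)
             (≤-reflexive (solve 2 (λ t δ → t :- (t :- δ) ⊜ δ) refl t (delayOf e))))

  clip-grows : ∀ {x y} e → x ≤ y → y ≤ proj₁ e → proj₁ e - delayOf e ≤ x →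
               clip x e + (y - x) ≤ clip y e
  clip-grows {x} {y} e@(t , _) x≤y y≤t s≤x = begin
    clip x e + (y - x)    ≤⟨ +-mono-≤ (⊔-lub (x≤y⇒0≤y-x s≤x) (+-mono-≤ (x⊓y≤y t x) ≤-refl)) ≤-refl ⟩
    (x - s) + (y - x)     ≡⟨ solve 3 (λ x y s → (x :- s) :+ (y :- x) ⊜ y :- s) refl x y s ⟩
    y - s                 ≤⟨ +-mono-≤ (⊓-glb y≤t ≤-refl) ≤-refl ⟩
    (t ⊓ y) - s           ≤⟨ x≤y⊔x 0# _ ⟩
    clip y e              ∎
    where open ≤-Reasoning
          s = t - delayOf e

  Chronological : List TimedEvent → Set
  Chronological = AllPairs (λ e f → proj₁ e ≤ proj₁ f)

  chronological-events : ∀ σ → Linked _≤_ (map Action.time σ) → Chronological (timedEvents σ)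
  chronological-events σ linked = go σ (Linked⇒AllPairs ≤-trans linked)
    where
    same : ∀ t es → Chronological (map (t ,_) es)
    same t []       = []
    same t (e ∷ es) = All.map⁺ (All.tabulate λ _ → ≤-refl) ∷ same t es

    later : ∀ t σ → All (t ≤_) (map Action.time σ) → All (λ e → t ≤ proj₁ e) (timedEvents σ)
    later t []      _        = []
    later t (α ∷ σ) (h ∷ hs) = All.++⁺ (All.map⁺ (All.tabulate λ _ → h)) (later t σ hs)

    go : ∀ σ → AllPairs _≤_ (map Action.time σ) → Chronological (timedEvents σ)
    go []      _        = []
    go (α ∷ σ) (h ∷ hs) = AllPairs.++⁺ (same (Action.time α) (Action.events α)) (go σ hs)
      (All.map⁺ (All.tabulate λ _ → later (Action.time α) σ h))

  split-at : ∀ x es → Chronological es → ∃[ as ] ∃[ bs ]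
    es ≡ as ++ bs × All (λ e → proj₁ e < x) as × All (λ e → x ≤ proj₁ e) bs × Chronological bs
  split-at x []       _          = [] , [] , refl , [] , [] , []
  split-at x (e ∷ es) (h ∷ hs) with x Order.≤? proj₁ e
  ... | yes x≤t = [] , e ∷ es , refl , [] , x≤t ∷ All.map (≤-trans x≤t) h , h ∷ hs
  ... | no  x≰t with split-at x es hs
  ...   | as , bs , refl , before , after , sorted =
    e ∷ as , bs , refl , (t≤x , λ t≡x → x≰t (≤-reflexive (sym t≡x))) ∷ before , after , sorted
    where
    t≤x : proj₁ e ≤ x
    t≤x with ≤-total x (proj₁ e)
    ... | inj₁ x≤t = contradiction x≤t x≰t
    ... | inj₂ t≤x = t≤x

module LowerBound {R : OrderedField} {S : Shape} (I : Input R S) where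
  open OrderedField R
  open OrderedFieldProperties R
  open Shape S
  open Input I
  open Model I
  open Kernel I
  open Schedules I

  module _ {F : Table} (isTable : IsTable F)
           (es : List TimedEvent)
           (chronological : Chronological es)
           (connected : Connected s₀ es)
           (served : All (λ e → All (Served e) (servedBy e)) es)
           (complete : ∀ q → Any (λ e → q ∈ servedBy e) es) where
    open IsTable isTable

    walked : List TimedEvent → Carrier
    walked = total (len ∘ walkOf)

    paid : Fin m → Carrier
    paid j = total (clip (arrival j)) es

    -- `done` precedes the last cut p; delays are counted only as far as they lie before a_j.
    record OpenBlock (j : Fin m) : Set where
      field
        p          : Fin m
        p≤j        : p Fin.≤ j
        done rest  : List TimedEvent
        es≡        : es ≡ done ++ rest
        sorted     : Chronological rest
        early      : All (λ e → proj₁ e < arrival p) done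
        bound      : F (inject₁ p) (endAfter s₀ done) ⊕ (arrival j - arrival p)
                     ≤⁺ [ walked done + paid j ]

    F-step-≤ : ∀ {p j} y z → p Fin.≤ j →
      F (suc j) z ≤⁺ F (inject₁ p) y ⊕ K p j y z ⊕ (arrival j - arrival p)
    F-step-≤ {p} {j} y z p≤j = ≤⁺-trans (≤⁺-reflexive (F-step j z))
      (proj₁ (minimum-glb (cartesianProduct (upTo j) (allFin N)) _)
        (∈-cartesianProduct⁺ (∈-filter⁺ (Fin._≤? j) (∈-allFin p) p≤j) (∈-allFin y)))

    close : ∀ {j} (b : OpenBlock j) B C → OpenBlock.rest b ≡ B ++ C →
      All (λ e → All (λ q → j Fin.< proj₁ q) (servedBy e)) C →
      F (suc j) (endAfter s₀ (OpenBlock.done b ++ B)) ≤⁺ [ walked (OpenBlock.done b ++ B) + paid j ]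
    close {j} b B C rest≡ late = ≤⁺-trans (≤⁺-reflexive (cong (F (suc j)) (endAfter-++ s₀ done B)))
      (≤⁺-trans (F-step-≤ y (endAfter y B) p≤j)
      (≤⁺-trans (≤⁺-reflexive (trans (⊕-assoc _ _ _)
                  (trans (cong (F (inject₁ p) y ⊕_) (+-comm _ _)) (sym (⊕-assoc _ _ _)))))
      (≤⁺-trans (⊕-mono-≤ bound K≤)
                [ ≤-reflexive (trans
                    (solve 3 (λ a b c → (a :+ b) :+ c ⊜ (a :+ c) :+ b) refl (walked done) (paid j) (walked B))
                    (cong (_+ paid j) (sym (total-++ _ done B)))) ])))
      where
      open OpenBlock b
      y = endAfter s₀ done
      es≡′ : es ≡ done ++ (B ++ C)
      es≡′ = trans es≡ (cong (done ++_) rest≡)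
      B-connected : Connected y B
      B-connected = proj₁ (connected-++⁻ B
        (proj₂ (connected-++⁻ done (subst (Connected s₀) es≡′ connected))))
      visited : ∀ {q} → InRange p j q → loc q ∈ y ∷ path B
      visited {q} (p≤q , q≤j) with find (complete q)
      ... | e , e∈ , q∈ with All.lookup (All.lookup served e∈) q∈ | ∈-++⁻ done (subst (e ∈_) es≡′ e∈)
      ...   | a≤t , _ | inj₁ e∈A = contradiction
        (≤-antisym (proj₁ t<) (≤-trans (arrival-mono-≤ p≤q) a≤t)) (proj₂ t<)
        where t< = All.lookup early e∈A
      ...   | a≤t , v∈ | inj₂ e∈ with ∈-++⁻ B e∈
      ...     | inj₁ e∈B = vertices⊆path B B-connected e∈B v∈
      ...     | inj₂ e∈C = contradiction q≤j (ℕ.<⇒≱ (All.lookup (All.lookup late e∈C) q∈))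
      K≤ : K p j y (endAfter y B) ≤ walked B
      K≤ = ≤-trans (K-≤-length y (path B) p≤j visited) (≤-reflexive (sym (total-len B B-connected)))

    paid-mono : ∀ {j k} → j Fin.≤ k → paid j ≤ paid k
    paid-mono j≤k = total-mono es (All.tabulate λ {e} _ → clip-mono e (arrival-mono-≤ j≤k))

    advance : ∀ {j k} → toℕ k ≡ suc (toℕ j) → OpenBlock j → OpenBlock k
    advance {j} {k} k≡1+j b
      with split-at (arrival k) (OpenBlock.rest b) (OpenBlock.sorted b)
    ... | B , C , rest≡ , B-early , C-late , C-sorted
      with All.all? (λ e → All.all? (λ q → k Fin.≤? proj₁ q) (servedBy e)) C
    ... | yes cut = record
      { p      = k
      ; p≤j    = Fin.≤-refl
      ; done   = done ++ B
      ; rest   = C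
      ; es≡    = trans es≡ (trans (cong (done ++_) rest≡) (sym (++-assoc done B C)))
      ; sorted = C-sorted
      ; early  = All.++⁺ (All.map (λ t< → <-≤ t< (arrival-mono-≤ (ℕ.≤-trans p≤j j≤k))) early) B-early
      ; bound  = ≤⁺-trans (≤⁺-reflexive (trans
                            (cong (F (inject₁ k) (endAfter s₀ (done ++ B)) ⊕_)
                                  (solve 1 (λ x → x :- x ⊜ :0) refl (arrival k)))
                            (trans (⊕-identity _) (cong (λ r → F r (endAfter s₀ (done ++ B))) inj≡))))
                 (≤⁺-trans (close b B C rest≡ (All.map (All.map (subst (ℕ._≤ _) k≡1+j)) cut))
                           [ +-mono-≤ ≤-refl (paid-mono j≤k) ])
      }
      where
      open OpenBlock b
      j≤k : j Fin.≤ k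
      j≤k = subst (toℕ j ℕ.≤_) (sym k≡1+j) (ℕ.n≤1+n _)
      inj≡ : inject₁ k ≡ suc j
      inj≡ = Fin.toℕ-injective (trans (Fin.toℕ-inject₁ k) k≡1+j)
      <-≤ : ∀ {x y z} → x < y → y ≤ z → x < z
      <-≤ (x≤y , x≢y) y≤z = ≤-trans x≤y y≤z , λ { refl → x≢y (≤-antisym x≤y y≤z) }
    ... | no ¬cut = record
      { p      = p
      ; p≤j    = ℕ.≤-trans p≤j j≤k
      ; done   = done
      ; rest   = rest
      ; es≡    = es≡
      ; sorted = sorted
      ; early  = early
      ; bound  = ≤⁺-trans (≤⁺-reflexive (trans (cong (F (inject₁ p) (endAfter s₀ done) ⊕_)
                            (solve 3 (λ p j k → k :- p ⊜ (j :- p) :+ (k :- j)) refl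
                                     (arrival p) (arrival j) (arrival k)))
                            (sym (⊕-assoc _ _ _))))
                 (≤⁺-trans (⊕-mono-≤ bound ≤-refl)
                           [ ≤-trans (≤-reflexive (+-assoc _ _ _)) (+-mono-≤ ≤-refl gap) ])
      }
      where
      open OpenBlock b
      j≤k : j Fin.≤ k
      j≤k = subst (toℕ j ℕ.≤_) (sym k≡1+j) (ℕ.n≤1+n _)
      straddling : ∀ {e q} → e ∈ C → q ∈ servedBy e → ¬ k Fin.≤ proj₁ q →
                   clip (arrival j) e + (arrival k - arrival j) ≤ clip (arrival k) e
      straddling {e@(t , _)} {q} e∈ q∈ k≰q = clip-grows e (arrival-mono-≤ j≤k) (All.lookup C-late e∈)
        (≤-trans (≤-by (delay-≥ t q∈)
                   (solve 3 (λ t δ a → (t :- δ) :+ δ ⊜ (t :- a) :+ a) refl t (delayOf e) (a q)))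
                 (arrival-mono-≤ (ℕ.≤-pred (subst (toℕ (proj₁ q) ℕ.<_) k≡1+j (ℕ.≰⇒> k≰q)))))
      C⊆es : ∀ {e} → e ∈ C → e ∈ es
      C⊆es {e} e∈ = subst (e ∈_) (sym (trans es≡ (cong (done ++_) rest≡))) (∈-++⁺ʳ done (∈-++⁺ʳ B e∈))
      gap : paid j + (arrival k - arrival j) ≤ paid k
      gap with find (All.¬All⇒Any¬ (λ e → All.all? (λ q → k Fin.≤? proj₁ q) (servedBy e)) C ¬cut)
      ... | e , e∈ , ¬all with find (All.¬All⇒Any¬ (λ q → k Fin.≤? proj₁ q) (servedBy e) ¬all)
      ...   | q , q∈ , k≰q = total-mono-gap es
        (All.tabulate λ {e} _ → clip-mono e (arrival-mono-≤ j≤k))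
        (lose (C⊆es e∈) (straddling e∈ q∈ k≰q))

    open-first : ∀ {j} → toℕ j ≡ 0 → OpenBlock j
    open-first {j} j≡0 = record
      { p = j ; p≤j = Fin.≤-refl ; done = [] ; rest = es ; es≡ = refl
      ; sorted = chronological ; early = []
      ; bound = ≤⁺-trans (≤⁺-reflexive (trans (cong₂ (λ r c → F r s₀ ⊕ c)
                            (Fin.toℕ-injective (trans (Fin.toℕ-inject₁ j) j≡0))
                            (solve 1 (λ x → x :- x ⊜ :0) refl (arrival j)))
                            (trans (⊕-identity _) F-start)))
                  [ ≤-trans (≤-reflexive (sym (+-identityˡ 0#)))
                      (+-mono-≤ ≤-refl (total-nonNeg _ es (All.tabulate λ _ → x≤x⊔y 0# _))) ]
      }

    open-block : ∀ n (n<m : n ℕ.< m) → OpenBlock (fromℕ< n<m)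
    open-block zero    0<m = open-first (Fin.toℕ-fromℕ< 0<m)
    open-block (suc n) n<m = advance
      (trans (Fin.toℕ-fromℕ< n<m) (cong suc (sym (Fin.toℕ-fromℕ< (ℕ.<⇒≤ n<m)))))
      (open-block n (ℕ.<⇒≤ n<m))

    walked+paid-≤ : ∀ j → walked es + paid j ≤ total eventCost es
    walked+paid-≤ j = ≤-trans
      (+-mono-≤ ≤-refl (total-mono es (All.map (λ {e} h → clip-≤-delay (arrival j) e
         (delay-nonNeg (proj₁ e) (servedBy e) (All.map proj₁ h))) served)))
      (≤-reflexive (total-+ _ _ es))

    F-≤-cost : ∃[ z ] F (fromℕ m) z ≤⁺ [ total eventCost es ]
    F-≤-cost with m ℕ.≟ 0
    ... | yes m≡0 = s₀ , ≤⁺-trans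
      (≤⁺-reflexive (trans (cong (λ r → F r s₀) (Fin.toℕ-injective (trans (Fin.toℕ-fromℕ m) m≡0))) F-start))
      [ ≤-trans (≤-reflexive (sym (+-identityˡ 0#)))
         (≤-trans (+-mono-≤ (subst (0# ≤_) (sym (total-len es connected)) (0≤lengthFrom s₀ (path es)))
                    (total-nonNeg _ es (All.map
                      (λ {e} h → delay-nonNeg (proj₁ e) (servedBy e) (All.map proj₁ h)) served)))
                  (≤-reflexive (total-+ _ delayOf es))) ]
    ... | no m≢0 = endAfter s₀ (done ++ rest) , ≤⁺-trans
      (≤⁺-trans (≤⁺-reflexive (cong (λ r → F r (endAfter s₀ (done ++ rest))) last≡))
                (close b rest [] (sym (++-identityʳ rest)) []))
      [ subst (λ fs → walked fs + paid j ≤ total eventCost es) es≡ (walked+paid-≤ j) ]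
      where
      instance nz = ℕ.≢-nonZero m≢0
      n<m : ℕ.pred m ℕ.< m
      n<m = ℕ.≤-reflexive (ℕ.suc-pred m)
      j = fromℕ< n<m
      b = open-block (ℕ.pred m) n<m
      open OpenBlock b
      last≡ : fromℕ m ≡ suc j
      last≡ = Fin.toℕ-injective (trans (Fin.toℕ-fromℕ m)
        (trans (sym (ℕ.suc-pred m)) (cong suc (sym (Fin.toℕ-fromℕ< n<m)))))

all-reverse : ∀ {A : Set} {P : A → Set} {xs} → All P xs → All P (reverse xs)
all-reverse pxs = All.tabulate λ x∈ → All.lookup pxs (Any.reverse⁻ x∈)

allPairs-reverse : ∀ {A : Set} {_~_ : A → A → Set} {xs} →
                   AllPairs _~_ xs → AllPairs (flip _~_) (reverse xs)
allPairs-reverse []                     = []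
allPairs-reverse {_~_ = _~_} {x ∷ xs} (h ∷ hs) = subst (AllPairs (flip _~_)) (sym (unfold-reverse x xs))
  (AllPairs.++⁺ (allPairs-reverse hs) ([] ∷ []) (All.map (_∷ []) (all-reverse h)))

allFin-sorted : ∀ n → AllPairs Fin._<_ (allFin n)
allFin-sorted n = AllPairs.tabulate⁺-< λ i<j → i<j

module UpperBound {R : OrderedField} {S : Shape} (I : Input R S) where
  open OrderedField R
  open OrderedFieldProperties R
  open Shape S
  open Input I
  open Model I
  open Kernel I
  open Schedules I

  site-mono-≤ : ∀ {i k} → i Fin.< k → site i ≤ site k
  site-mono-≤ i<k = proj₁ (site-mono i<k)

  endFrom-∷ʳ : ∀ y vs z → endFrom y (vs ++ z ∷ []) ≡ z
  endFrom-∷ʳ y vs z = endFrom-++ y vs (z ∷ [])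

  -- φ bounds the distance still to be swept.
  sweep-length : ∀ (φ : Fin N → Carrier) {c} v ws z →
    AllPairs (λ v w → d v w + φ w ≤ φ v) (v ∷ ws) → All (λ w → d w z ≤ φ w + c) (v ∷ ws) →
    lengthFrom v (ws ++ z ∷ []) ≤ φ v + c
  sweep-length φ v []       z _ (h ∷ []) = ≤-trans (≤-reflexive (+-identityʳ _)) h
  sweep-length φ {c} v (w ∷ ws) z ((hw ∷ _) ∷ hs) (_ ∷ ks) =
    ≤-trans (+-mono-≤ ≤-refl (sweep-length φ w ws z hs ks))
    (≤-trans (≤-reflexive (sym (+-assoc _ _ _))) (+-mono-≤ hw ≤-refl))

  block-walk : ∀ {p j} → p Fin.≤ j → ∀ y z → ∃[ ws ]
    endFrom y ws ≡ z × lengthFrom y ws ≤ K p j y z × (∀ {q} → InRange p j q → loc q ∈ y ∷ ws)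
  block-walk {p} {j} p≤j y z with L-attained p≤j | U-attained p≤j
  ... | l , l∈ , L≡ | u , u∈ , U≡ = choose (⊓-cases α β)
    where
    α = ∣ site y - L p j ∣ + ∣ U p j - site z ∣
    β = ∣ site y - U p j ∣ + ∣ L p j - site z ∣

    ⊓-cases : ∀ x y → x ≤ x ⊓ y ⊎ y ≤ x ⊓ y
    ⊓-cases x y = Sum.map (⊓-glb ≤-refl) (λ y≤x → ⊓-glb y≤x ≤-refl) (≤-total x y)

    inside? = λ i → (L p j Order.≤? site i) ×-dec (site i Order.≤? U p j)
    inside = filter inside? (allFin N)

    inside-sorted : AllPairs Fin._<_ inside
    inside-sorted = AllPairs.filter⁺ inside? (allFin-sorted N)

    loc∈inside : ∀ {q} → InRange p j q → loc q ∈ inside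
    loc∈inside {q} r = ∈-filter⁺ inside? (∈-allFin (loc q)) (L-≤ r , ≤-U r)

    above : ∀ {i} → i ∈ inside → L p j ≤ site i
    above i∈ = proj₁ (proj₂ (∈-filter⁻ inside? {xs = allFin N} i∈))
    below : ∀ {i} → i ∈ inside → site i ≤ U p j
    below i∈ = proj₂ (proj₂ (∈-filter⁻ inside? {xs = allFin N} i∈))

    choose : α ≤ α ⊓ β ⊎ β ≤ α ⊓ β → ∃[ ws ]
      endFrom y ws ≡ z × lengthFrom y ws ≤ K p j y z × (∀ {q} → InRange p j q → loc q ∈ y ∷ ws)
    choose (inj₁ α≤) = loc l ∷ (inside ++ z ∷ []) , endFrom-∷ʳ (loc l) inside z ,
      (begin
        ∣ site y - siteOf l ∣ + lengthFrom (loc l) (inside ++ z ∷ [])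
          ≤⟨ +-mono-≤ ≤-refl (sweep-length φ (loc l) inside z
               (All.tabulate (λ i∈ → rise (≤-trans (≤-reflexive (sym L≡)) (above i∈)))
                 ∷ AllPairs.map (rise ∘ site-mono-≤) inside-sorted)
               (finish (≤-U l∈) ∷ All.tabulate (finish ∘ below))) ⟩
        ∣ site y - siteOf l ∣ + (φ (loc l) + ∣ U p j - site z ∣)
          ≡⟨ cong (λ x → ∣ site y - x ∣ + ((U p j - x) + ∣ U p j - site z ∣)) (sym L≡) ⟩
        ∣ site y - L p j ∣ + ((U p j - L p j) + ∣ U p j - site z ∣)
          ≡⟨ solve 3 (λ a b c → a :+ (b :+ c) ⊜ b :+ (a :+ c)) refl _ _ _ ⟩
        (U p j - L p j) + α
          ≤⟨ +-mono-≤ ≤-refl α≤ ⟩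
        K p j y z ∎) ,
      λ r → there (there (∈-++⁺ˡ (loc∈inside r)))
      where
      open ≤-Reasoning
      φ : Fin N → Carrier
      φ w = U p j - site w
      rise : ∀ {v w} → site v ≤ site w → d v w + φ w ≤ φ v
      rise {v} {w} v≤w = ≤-reflexive (trans (cong (_+ φ w) (x≤y⇒∣x-y∣≡y-x v≤w))
        (solve 3 (λ v w u → (w :- v) :+ (u :- w) ⊜ u :- v) refl (site v) (site w) (U p j)))
      finish : ∀ {w} → site w ≤ U p j → d w z ≤ φ w + ∣ U p j - site z ∣
      finish {w} w≤U = ≤-trans (∣x-z∣-triangle (site w) (U p j) (site z))
        (+-mono-≤ (≤-reflexive (x≤y⇒∣x-y∣≡y-x w≤U)) ≤-refl)
    choose (inj₂ β≤) = loc u ∷ (reverse inside ++ z ∷ []) , endFrom-∷ʳ (loc u) (reverse inside) z ,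
      (begin
        ∣ site y - siteOf u ∣ + lengthFrom (loc u) (reverse inside ++ z ∷ [])
          ≤⟨ +-mono-≤ ≤-refl (sweep-length φ (loc u) (reverse inside) z
               (all-reverse (All.tabulate λ i∈ → fall (≤-trans (below i∈) (≤-reflexive U≡)))
                 ∷ AllPairs.map (fall ∘ site-mono-≤) (allPairs-reverse inside-sorted))
               (finish (L-≤ u∈) ∷ all-reverse (All.tabulate (finish ∘ above)))) ⟩
        ∣ site y - siteOf u ∣ + (φ (loc u) + ∣ L p j - site z ∣)
          ≡⟨ cong (λ x → ∣ site y - x ∣ + ((x - L p j) + ∣ L p j - site z ∣)) (sym U≡) ⟩
        ∣ site y - U p j ∣ + ((U p j - L p j) + ∣ L p j - site z ∣)
          ≡⟨ solve 3 (λ a b c → a :+ (b :+ c) ⊜ b :+ (a :+ c)) refl _ _ _ ⟩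
        (U p j - L p j) + β
          ≤⟨ +-mono-≤ ≤-refl β≤ ⟩
        K p j y z ∎) ,
      λ r → there (there (∈-++⁺ˡ (Any.reverse⁺ (loc∈inside r))))
      where
      open ≤-Reasoning
      φ : Fin N → Carrier
      φ w = site w - L p j
      fall : ∀ {v w} → site w ≤ site v → d v w + φ w ≤ φ v
      fall {v} {w} w≤v = ≤-reflexive (trans (cong (_+ φ w) (trans (∣x-y∣-sym _ _) (x≤y⇒∣x-y∣≡y-x w≤v)))
        (solve 3 (λ v w u → (v :- w) :+ (w :- u) ⊜ v :- u) refl (site v) (site w) (L p j)))
      finish : ∀ {w} → L p j ≤ site w → d w z ≤ φ w + ∣ L p j - site z ∣
      finish {w} L≤w = ≤-trans (∣x-z∣-triangle (site w) (L p j) (site z))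
        (+-mono-≤ (≤-reflexive (trans (∣x-y∣-sym _ _) (x≤y⇒∣x-y∣≡y-x L≤w))) ≤-refl)

  elective-∷ʳ : ∀ {D} es e → Elective D es → All (_∉ D) (servedBy e) →
    All (λ f → All (_∉ servedBy f) (servedBy e)) es → All (Served e) (servedBy e) →
    Elective D (es ++ e ∷ [])
  elective-∷ʳ []       e _        e∉D _        ok =
    All.zipWith (λ ((a≤t , v∈) , q∉D) → a≤t , q∉D , v∈) (ok , e∉D) , _
  elective-∷ʳ {D} (f ∷ es) e (h , hs) e∉D (e∉f ∷ e∉es) ok =
    h , elective-∷ʳ es e hs (All.zipWith (λ {q} → λ (q∉f , q∉D) → ∉-++ {q} q∉f q∉D) (e∉f , e∉D)) e∉es ok
    where
    ∉-++ : ∀ {q} → q ∉ servedBy f → q ∉ D → q ∉ servedBy f ++ D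
    ∉-++ q∉f q∉D q∈ with ∈-++⁻ (servedBy f) q∈
    ... | inj₁ q∈f = q∉f q∈f
    ... | inj₂ q∈D = q∉D q∈D

  record Plan (r : Fin (suc m)) (z : Fin N) (c : Carrier) : Set where
    field
      plan          : List TimedEvent
      chronological : Chronological plan
      dated         : All (λ e → ∀ k → toℕ r ℕ.≤ toℕ k → proj₁ e ≤ arrival k) plan
      connected     : Connected s₀ plan
      end≡          : endAfter s₀ plan ≡ z
      elective      : Elective [] plan
      old           : All (λ e → All (λ q → toℕ (proj₁ q) ℕ.< toℕ r) (servedBy e)) plan
      complete      : ∀ q → toℕ (proj₁ q) ℕ.< toℕ r → Any (λ e → q ∈ servedBy e) plan
      cost≤         : total eventCost plan ≤ c

  extend : ∀ {p j y c} → p Fin.≤ j → ∀ z → Plan (inject₁ p) y c →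
           Plan (suc j) z (c + K p j y z + (arrival j - arrival p))
  extend {p} {j} {y} {c} p≤j z P with block-walk p≤j y z
  ... | ws , end≡z , length≤ , visits = record
    { plan          = plan ++ e ∷ []
    ; chronological = AllPairs.++⁺ chronological ([] ∷ [])
                        (All.map (λ dated → dated j (p≤ p≤j) ∷ []) dated)
    ; dated         = All.++⁺
                        (All.map (λ dated k j<k → dated k (p≤ (ℕ.≤-trans p≤j (ℕ.<⇒≤ j<k)))) dated)
                        ((λ k j<k → arrival-mono-≤ (ℕ.<⇒≤ j<k)) ∷ [])
    ; connected     = connected-++⁺ plan connected (sym end≡ , _)
    ; end≡          = trans (endAfter-++ s₀ plan (e ∷ []))
                      (trans (cong₂ endFrom end≡ (++-identityʳ ws)) end≡z)
    ; elective      = elective-∷ʳ plan e elective (All.tabulate λ _ ())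
                        (All.map (λ old → All.tabulate λ q∈e q∈f → ℕ.<⇒≱ (<p (All.lookup old q∈f))
                                    (proj₁ (∈-requests⁻ q∈e))) old)
                        (All.tabulate λ q∈ → arrival-mono-≤ (proj₂ (∈-requests⁻ q∈)) ,
                                             visits (∈-requests⁻ q∈))
    ; old           = All.++⁺
                        (All.map (All.map λ q<p → ℕ.≤-trans (<p q<p) (ℕ.≤-trans p≤j (ℕ.n≤1+n _))) old)
                        (All.tabulate (λ q∈ → ℕ.s≤s (proj₂ (∈-requests⁻ q∈))) ∷ [])
    ; complete      = complete′
    ; cost≤         = ≤-trans (≤-reflexive (trans (total-++ eventCost plan (e ∷ []))
                                              (cong (total eventCost plan +_) (+-identityʳ _))))
                      (≤-trans (+-mono-≤ cost≤ (+-mono-≤ length≤ delay≤)) (≤-reflexive (sym (+-assoc _ _ _))))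
    }
    where
    open Plan P
    e : TimedEvent
    e = arrival j , record { walk = y then ws ; served = requests p j }
    p≤ : ∀ {n} → toℕ p ℕ.≤ n → toℕ (inject₁ p) ℕ.≤ n
    p≤ = subst (ℕ._≤ _) (sym (Fin.toℕ-inject₁ p))
    <p : ∀ {n} → n ℕ.< toℕ (inject₁ p) → n ℕ.< toℕ p
    <p = subst (_ ℕ.<_) (Fin.toℕ-inject₁ p)
    complete′ : ∀ q → toℕ (proj₁ q) ℕ.< suc (toℕ j) → Any (λ e → q ∈ servedBy e) (plan ++ e ∷ [])
    complete′ q q≤j with p Fin.≤? proj₁ q
    ... | yes p≤q = Any.++⁺ʳ plan (here (∈-requests⁺ (p≤q , ℕ.≤-pred q≤j)))
    ... | no  p≰q = Any.++⁺ˡ (complete q (subst (_ ℕ.<_) (sym (Fin.toℕ-inject₁ p)) (ℕ.≰⇒> p≰q)))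
    delay≤ : delay (arrival j) (requests p j) ≤ arrival j - arrival p
    delay≤ = delay-≤ (arrival j) (requests p j) (x≤y⇒0≤y-x (arrival-mono-≤ p≤j))
      (All.tabulate λ {q} q∈ → ≤-by (arrival-mono-≤ (proj₁ (∈-requests⁻ q∈)))
        (solve 3 (λ j q p → (j :- q) :+ q ⊜ p :+ (j :- p)) refl (arrival j) (a q) (arrival p)))

  weaken : ∀ {r z c c′} → c ≤ c′ → Plan r z c → Plan r z c′
  weaken c≤c′ P = record
    { plan = plan ; chronological = chronological ; dated = dated ; connected = connected ; end≡ = end≡
    ; elective = elective ; old = old ; complete = complete ; cost≤ = ≤-trans cost≤ c≤c′ }
    where open Plan P

  plan-for : ∀ {F} → IsTable F → ∀ n r → toℕ r ℕ.< n → ∀ z c → F r z ≤⁺ [ c ] → Plan r z c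
  plan-for isTable (suc n) zero    _   z c F≤c with z Fin.≟ s₀
  ... | no  z≢s₀ = contradiction (≤⁺-trans (≤⁺-reflexive (sym (IsTable.F-other isTable z z≢s₀))) F≤c) λ ()
  ... | yes refl with ≤⁺-trans (≤⁺-reflexive (sym (IsTable.F-start isTable))) F≤c
  ...   | [ 0≤c ] = record
    { plan = [] ; chronological = [] ; dated = [] ; connected = _ ; end≡ = refl ; elective = _
    ; old = [] ; complete = λ _ () ; cost≤ = 0≤c }
  plan-for {F} isTable (suc n) (suc j) j<n z c F≤c
    with minimum-attained (cartesianProduct (upTo j) (allFin N)) _
           (≤⁺-trans (≤⁺-reflexive (sym (IsTable.F-step isTable j z))) F≤c)
  ... | (p , y) , py∈ , f≤c
    with p≤j ← proj₂ (∈-filter⁻ (Fin._≤? j) {xs = allFin m}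
                       (proj₁ (∈-cartesianProduct⁻ (upTo j) (allFin N) py∈)))
    with F (inject₁ p) y in eq | f≤c
  ... | [ c′ ] | [ le ] = weaken le (extend p≤j z
    (plan-for isTable n (inject₁ p)
      (subst (ℕ._< n) (sym (Fin.toℕ-inject₁ p)) (ℕ.<-≤-trans (ℕ.s≤s p≤j) (ℕ.≤-pred j<n)))
      y c′ (≤⁺-reflexive eq)))

  schedule : List TimedEvent → Schedule
  schedule = map λ (t , e) → record { time = t ; events = e ∷ [] }

  timedEvents-schedule : ∀ es → timedEvents (schedule es) ≡ es
  timedEvents-schedule []       = refl
  timedEvents-schedule (e ∷ es) = cong (e ∷_) (timedEvents-schedule es)

  feasible : ∀ {z c} → Plan (fromℕ m) z c → ∃[ σ ] Feasible σ × cost σ ≤ c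
  feasible P = schedule plan , record
    { chronological = AllPairs⇒Linked (AllPairs.map⁺ (AllPairs.map⁺ chronological))
    ; connected     = subst (Connected s₀) es≡ connected
    ; elective      = subst (Elective []) es≡ elective
    ; complete      = λ q → subst (Any (λ e → q ∈ servedBy e)) es≡
                        (complete q (subst (toℕ (proj₁ q) ℕ.<_) (sym (Fin.toℕ-fromℕ m)) (Fin.toℕ<n (proj₁ q))))
    } , subst (λ es → total eventCost es ≤ _) es≡ cost≤
    where
    open Plan P
    es≡ = sym (timedEvents-schedule plan)

  optimal : ∀ {F} → IsTable F → IsOPT (minimum (allFin N) (F (fromℕ m)))
  optimal {F} isTable = below , greatest
    where
    below : ∀ c → (∃[ σ ] Feasible σ × cost σ ≡ c) → minimum (allFin N) (F (fromℕ m)) ≤⁺ [ c ]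
    below _ (σ , feasible , refl)
      with LowerBound.F-≤-cost I isTable (timedEvents σ)
             (chronological-events σ (Feasible.chronological feasible))
             (Feasible.connected feasible)
             (elective⇒served (timedEvents σ) (Feasible.elective feasible))
             (Feasible.complete feasible)
    ... | z , F≤ = ≤⁺-trans (proj₁ (minimum-glb (allFin N) (F (fromℕ m))) (∈-allFin z)) F≤

    greatest : ∀ b → (∀ c → (∃[ σ ] Feasible σ × cost σ ≡ c) → b ≤⁺ [ c ]) →
               b ≤⁺ minimum (allFin N) (F (fromℕ m))
    greatest b b≤ with minimum (allFin N) (F (fromℕ m)) in eq
    ... | ⊤⁺    = b ≤⊤⁺
    ... | [ c ] with minimum-attained (allFin N) (F (fromℕ m)) (≤⁺-reflexive eq)
    ...   | z , _ , F≤c with feasible (plan-for isTable _ (fromℕ m) ℕ.≤-refl z c F≤c)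
    ...     | σ , feasible , cost≤ = ≤⁺-trans (b≤ (cost σ) (σ , feasible , refl)) [ cost≤ ]

-- Program logic

allPairs-ʳ++⁻ : ∀ {A : Set} {_~_ : A → A → Set} xs {ys} → AllPairs _~_ (xs ʳ++ ys) →
                All (λ x → All (x ~_) ys) xs × AllPairs _~_ ys
allPairs-ʳ++⁻ []       h = [] , h
allPairs-ʳ++⁻ (x ∷ xs) h with allPairs-ʳ++⁻ xs h
... | hs , (h₁ ∷ h₂) = h₁ ∷ All.map All.tail hs , h₂

-- The moment of a traversal of xs at which i is about to be visited; `done` is in reverse order.
record Stage {A : Set} (_~_ : A → A → Set) (xs done : List A) (i : A) : Set where
  field
    current : i ∈ xs
    past    : ∀ {y} → y ∈ done → y ∈ xs × y ~ i
    future  : ∀ {y} → y ∈ xs → y ∈ i ∷ done ⊎ i ~ y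

stage : ∀ {A : Set} {_~_ : A → A → Set} done i todo → AllPairs _~_ (done ʳ++ (i ∷ todo)) →
        Stage _~_ (done ʳ++ (i ∷ todo)) done i
stage done i todo sorted with allPairs-ʳ++⁻ done sorted
... | before , (after ∷ _) = record
  { current = Any.reverseAcc⁺ (i ∷ todo) done (inj₁ (here refl))
  ; past    = λ y∈ → Any.reverseAcc⁺ (i ∷ todo) done (inj₂ y∈) , All.head (All.lookup before y∈)
  ; future  = λ y∈ → locate (Any.reverseAcc⁻ (i ∷ todo) done y∈)
  }
  where
  locate : ∀ {y} → y ∈ i ∷ todo ⊎ y ∈ done → y ∈ i ∷ done ⊎ _
  locate (inj₁ (here y≡i))  = inj₁ (here y≡i)
  locate (inj₁ (there y∈))  = inj₂ (All.lookup after y∈)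
  locate (inj₂ y∈)          = inj₁ (there y∈)

≤⇒≡⊎< : ∀ {n} {i k : Fin n} → i Fin.≤ k → i ≡ k ⊎ i Fin.< k
≤⇒≡⊎< = Sum.swap ∘ Sum.map₂ Fin.toℕ-injective ∘ ℕ.m≤n⇒m<n∨m≡n

module Hoare {R : OrderedField} {S : Shape} (I : Input R S) {k : ℕ} (layout : Vec Array k) where
  open Syntax S layout
  open Semantics I layout

  -- A record, so that the statement can be inferred from the goal.
  record After (s : Stmt) (μ : Store) (P : Store → Set) : Set where
    constructor after
    field
      holds : P (exec s μ)

  open After public

  skip-rule : ∀ {μ P} → P μ → After skip μ P
  skip-rule = after

  assign : ∀ {A r c e μ P} → P (write μ A (⟦ r ⟧ μ) (⟦ c ⟧ μ) (⟦ e ⟧ μ)) → After (A ⟨ r , c ⟩≔ e) μ P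
  assign = after

  infixr 2 _»_
  _»_ : ∀ {s s′ μ P Q} → After s μ P → (∀ {μ′} → P μ′ → After s′ μ′ Q) → After (s ⨾ s′) μ Q
  after p » f = after (holds (f p))

  seq : ∀ {s s′ μ P} → After s μ (λ μ′ → After s′ μ′ P) → After (s ⨾ s′) μ P
  seq h = after (holds (holds h))

  branch : ∀ {b s s′ μ P} → (Holds b μ → After s μ P) → (¬ Holds b μ → After s′ μ P) →
           After (if b then s else s′) μ P
  branch {b} {s} {s′} {μ} {P} f g = after h
    where
    h : P (exec (if b then s else s′) μ)
    h with holds? b μ
    ... | yes t = holds (f t)
    ... | no ¬t = holds (g ¬t)

  loop : ∀ {n} {xs : List (Fin n)} {s : Fin n → Stmt} {_~_ : Fin n → Fin n → Set} →
    AllPairs _~_ xs → (Inv : List (Fin n) → Store → Set) →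
    (∀ {done i μ} → Stage _~_ xs done i → Inv done μ → After (s i) μ (Inv (i ∷ done))) →
    ∀ {μ} → Inv [] μ → After (for xs s) μ (Inv (reverse xs))
  loop {n} {xs} {s} {_~_} sorted Inv step inv = after (go [] xs refl inv)
    where
    go : ∀ done todo → done ʳ++ todo ≡ xs → ∀ {μ} → Inv done μ → Inv (todo ʳ++ done) (execFor todo s μ)
    go done []         _    inv = inv
    go done (i ∷ todo) refl inv = go (i ∷ done) todo refl (holds (step (stage done i todo sorted) inv))

  consequence : ∀ {s μ P Q} → (∀ {μ′} → P μ′ → Q μ′) → After s μ P → After s μ Q
  consequence f (after p) = after (f p)

  write-here : ∀ μ A r c v → write μ A r c v A r c ≡ v
  write-here μ A r c v with A Fin.≟ A
  ... | no A≢A = contradiction refl A≢A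
  ... | yes refl with (r Fin.≟ r) ×-dec (c Fin.≟ c)
  ...   | yes _  = refl
  ...   | no neq = contradiction (refl , refl) neq

  write-elsewhere : ∀ μ A r c v {r′ c′} → ¬ (r ≡ r′ × c ≡ c′) → write μ A r c v A r′ c′ ≡ μ A r′ c′
  write-elsewhere μ A r c v {r′} {c′} neq with A Fin.≟ A
  ... | no A≢A = contradiction refl A≢A
  ... | yes refl with (r Fin.≟ r′) ×-dec (c Fin.≟ c′)
  ...   | yes eq = contradiction eq neq
  ...   | no _   = refl

module Glb (R : OrderedField) where
  open OrderedField R
  open OrderedFieldProperties R

  glb-∪ˡ : ∀ {A : Set} {P Q : A → Set} {f u v} → u ≤⁺ v → IsGlb P f u → IsGlb Q f v →
           IsGlb (λ x → P x ⊎ Q x) f u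
  glb-∪ˡ u≤v (u≤f , f≤u) (v≤f , f≤v) =
    (λ { (inj₁ Px) → u≤f Px ; (inj₂ Qx) → ≤⁺-trans u≤v (v≤f Qx) }) ,
    λ b b≤f → f≤u b (b≤f ∘ inj₁)

  glb-⊆ : ∀ {A : Set} {P P′ : A → Set} {f v} → (∀ {x} → P x → P′ x) → (∀ {x} → P′ x → P x) →
          IsGlb P f v → IsGlb P′ f v
  glb-⊆ P⊆P′ P′⊆P = glb-resp P⊆P′ P′⊆P (λ _ → refl)

  glb-singleton : ∀ {A : Set} {f : A → Carrier⁺} x → IsGlb (_≡ x) f (f x)
  glb-singleton x = (λ { refl → ≤⁺-refl }) , λ b b≤f → b≤f refl

  glb-∅ : ∀ {A : Set} {P : A → Set} {f} → (∀ {x} → ¬ P x) → IsGlb P f ⊤⁺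
  glb-∅ ¬P = (λ Px → contradiction Px ¬P) , λ b _ → b ≤⊤⁺

  ≰⁺⇒≥⁺ : ∀ {u v} → ¬ u ≤⁺ v → v ≤⁺ u
  ≰⁺⇒≥⁺ {u} {v} u≰v with ≤⁺-total u v
  ... | inj₁ u≤v = contradiction u≤v u≰v
  ... | inj₂ v≤u = v≤u

  ≰⇒≥ : ∀ {x y} → ¬ x ≤ y → y ≤ x
  ≰⇒≥ {x} {y} x≰y with ≤-total x y
  ... | inj₁ x≤y = contradiction x≤y x≰y
  ... | inj₂ y≤x = y≤x

  -- One step of a scan: δ x y is the distance from y to the later point x.
  module Scan {A : Set} (f : A → Carrier⁺) (δ : A → A → Carrier)
              (δ-refl : ∀ x → δ x x ≡ 0#) (δ-trans : ∀ x y z → δ y z + δ x y ≡ δ x z) where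

    ScanGlb : List A → A → Carrier⁺ → Set
    ScanGlb done x = IsGlb (_∈ done) (λ y → f y ⊕ δ x y)

    private
      here⊎there : ∀ {x i : A} {done} → x ∈ done ⊎ x ≡ i → x ∈ i ∷ done
      here⊎there (inj₁ x∈)  = there x∈
      here⊎there (inj₂ x≡i) = here x≡i

      there⊎here : ∀ {x i : A} {done} → x ∈ i ∷ done → x ∈ done ⊎ x ≡ i
      there⊎here (here x≡i) = inj₂ x≡i
      there⊎here (there x∈) = inj₁ x∈

      moved : ∀ {done x v} i → ScanGlb done x v → ScanGlb done i (v ⊕ δ i x)
      moved {x = x} i h = glb-resp (λ p → p) (λ p → p)
        (λ {y} _ → trans (⊕-assoc (f y) _ _) (cong (f y ⊕_) (δ-trans i x y))) (glb-⊕ (δ i x) h)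

      start : ∀ i → IsGlb (_≡ i) (λ y → f y ⊕ δ i y) (f i)
      start i = subst (IsGlb (_≡ i) (λ y → f y ⊕ δ i y))
        (trans (cong (f i ⊕_) (δ-refl i)) (⊕-identity (f i))) (glb-singleton i)

    scan-restart : ∀ {done x v} i → f i ≤⁺ v ⊕ δ i x → ScanGlb done x v → ScanGlb (i ∷ done) i (f i)
    scan-restart i le h = glb-⊆ (here⊎there ∘ Sum.swap) (Sum.swap ∘ there⊎here)
      (glb-∪ˡ le (start i) (moved i h))

    scan-continue : ∀ {done x v} i → ¬ f i ≤⁺ v ⊕ δ i x → ScanGlb done x v →
                    ScanGlb (i ∷ done) i (v ⊕ δ i x)
    scan-continue i ¬le h = glb-⊆ here⊎there there⊎here
      (glb-∪ˡ (≰⁺⇒≥⁺ ¬le) (moved i h) (start i))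

module Transform {R : OrderedField} {S : Shape} (I : Input R S) where
  open OrderedField R
  open OrderedFieldProperties R
  open Glb R
  open Shape S
  open Input I
  open Model I using (d)
  open UpperBound I using (site-mono-≤)
  open DistanceTransform S
  open Syntax S layout
  open Semantics I layout
  open Hoare I layout

  record TransformFrame (h : Fin (suc m)) (μ₀ μ : Store) : Set where
    field
      𝐅≡      : ∀ r z → μ 𝐅 r z ≡ μ₀ 𝐅 r z
      𝐆≡      : ∀ {r} z → r ≢ h → μ 𝐆 r z ≡ μ₀ 𝐆 r z
      epochL≡ : ∀ e → μ epochL zero e ≡ μ₀ epochL zero e
      epochU≡ : ∀ e → μ epochU zero e ≡ μ₀ epochU zero e

  -- f holds the values scanned, in the order _~_; δ is the signed distance in its direction.
  module DirectedScan (h : Fin (suc m)) (μ₀ : Store) (f : Fin N → Carrier⁺)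
                      (δ : Fin N → Fin N → Carrier)
                      (δ-refl : ∀ x → δ x x ≡ 0#) (δ-trans : ∀ x y z → δ y z + δ x y ≡ δ x z)
                      (_~_ : Fin N → Fin N → Set) (~-irrefl : ∀ {x} → ¬ x ~ x)
                      (~-asym : ∀ {x y} → x ~ y → ¬ y ~ x) where
    open Scan f δ δ-refl δ-trans public

    record ScanInv (done : List (Fin N)) (μ : Store) : Set where
      field
        frame : TransformFrame h μ₀ μ
        best≡ : ScanGlb done (μ prev zero zero) (μ best zero zero)
        row   : ∀ {x} → x ∈ done → IsGlb (λ y → y ≡ x ⊎ y ~ x) (λ y → f y ⊕ δ x y) (μ 𝐆 h x)
        fresh : ∀ {x} → x ∉ done → μ 𝐆 h x ≡ μ₀ 𝐆 h x

    update : ∀ {xs done i μ μ′} → (∀ x → x ∈ xs) → Stage _~_ xs done i → ScanInv done μ →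
      ScanGlb (i ∷ done) (μ′ prev zero zero) (μ′ best zero zero) →
      (∀ {r z} → μ′ 𝐅 r z ≡ μ 𝐅 r z) →
      μ′ 𝐆 h i ≡ μ′ best zero zero →
      (∀ {r z} → ¬ (h ≡ r × i ≡ z) → μ′ 𝐆 r z ≡ μ 𝐆 r z) →
      (∀ {e} → μ′ epochL zero e ≡ μ epochL zero e) →
      (∀ {e} → μ′ epochU zero e ≡ μ epochU zero e) →
      μ′ prev zero zero ≡ i → ScanInv (i ∷ done) μ′
    update {xs} {done} {i} {μ} {μ′} all st inv glb F≡ here≡ G≡ l≡ u≡ refl = record
      { frame = record
        { 𝐅≡      = λ r z → trans F≡ (𝐅≡ r z)
        ; 𝐆≡      = λ z r≢h → trans (G≡ λ (h≡r , _) → r≢h (sym h≡r)) (𝐆≡ z r≢h)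
        ; epochL≡ = λ e → trans l≡ (epochL≡ e)
        ; epochU≡ = λ e → trans u≡ (epochU≡ e)
        }
      ; best≡ = glb
      ; row   = row′
      ; fresh = λ x∉ → trans (G≡ λ (_ , i≡x) → x∉ (here (sym i≡x))) (fresh (x∉ ∘ there))
      }
      where
      open ScanInv inv
      open TransformFrame frame
      visited : ∀ {y} → y ≡ i ⊎ y ~ i → y ∈ i ∷ done
      visited (inj₁ y≡i) = here y≡i
      visited {y} (inj₂ y~i) with Stage.future st (all y)
      ... | inj₁ y∈  = y∈
      ... | inj₂ i~y = contradiction i~y (~-asym y~i)
      row′ : ∀ {x} → x ∈ i ∷ done → IsGlb (λ y → y ≡ x ⊎ y ~ x) (λ y → f y ⊕ δ x y) (μ′ 𝐆 h x)
      row′ (here refl) = subst (IsGlb (λ y → y ≡ i ⊎ y ~ i) _) (sym here≡)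
        (glb-⊆ (λ { (here y≡i) → inj₁ y≡i ; (there y∈) → inj₂ (proj₂ (Stage.past st y∈)) }) visited glb)
      row′ {x} (there x∈) = subst (IsGlb (λ y → y ≡ x ⊎ y ~ x) _)
        (sym (G≡ λ { (_ , refl) → ~-irrefl (proj₂ (Stage.past st x∈)) })) (row x∈)

  Transformed : Fin (suc m) → Store → Set
  Transformed h μ = ∀ x → IsGlb (λ _ → ⊤) (λ y → μ 𝐅 h y ⊕ d y x) (μ 𝐆 h x)

  module _ (h : Fin (suc m)) where

    module Forward (μ₀ : Store) = DirectedScan h μ₀ (μ₀ 𝐅 h) (λ x y → site x - site y)
      (λ x → solve 1 (λ x → x :- x ⊜ :0) refl (site x))
      (λ x y z → solve 3 (λ x y z → (y :- z) :+ (x :- y) ⊜ x :- z) refl (site x) (site y) (site z))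
      Fin._<_ (ℕ.<-irrefl refl) ℕ.<-asym

    module Backward (μ₀ : Store) = DirectedScan h μ₀ (μ₀ 𝐆 h) (λ x y → site y - site x)
      (λ x → solve 1 (λ x → x :- x ⊜ :0) refl (site x))
      (λ x y z → solve 3 (λ x y z → (z :- y) :+ (y :- x) ⊜ z :- x) refl (site x) (site y) (site z))
      Fin._>_ (ℕ.<-irrefl refl) ℕ.<-asym

    forward-spec : ∀ μ₀ → After (forwardScan h) μ₀ (Forward.ScanInv μ₀ (reverse (allFin N)))
    forward-spec μ₀ = seq $ seq $ assign $ seq $ assign $ assign $
      loop (allFin-sorted N) ScanInv step record
        { frame = record
          { 𝐅≡ = λ _ _ → refl ; 𝐆≡ = λ _ _ → refl ; epochL≡ = λ _ → refl ; epochU≡ = λ _ → refl }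
        ; best≡ = glb-∅ λ ()
        ; row   = λ ()
        ; fresh = λ _ → refl
        }
      where
      open Forward μ₀
      step : ∀ {done i μ} → Stage Fin._<_ (allFin N) done i → ScanInv done μ →
             After _ μ (ScanInv (i ∷ done))
      step {done} {i} {μ} st inv = seq $ assign $ seq $ branch
        (λ le → seq $ assign $ assign $ seq $ assign $ seq $ assign $ assign $
          update ∈-allFin st inv
            (subst (ScanGlb (i ∷ done) i) (sym (𝐅≡ h i)) (scan-restart i (subst (_≤⁺ _) (𝐅≡ h i) le) best≡))
            refl (write-here _ 𝐆 h i _) (λ ne → write-elsewhere _ 𝐆 h i _ ne) refl refl refl)
        (λ ¬le → skip-rule $ seq $ assign $ seq $ assign $ assign $
          update ∈-allFin st inv
            (scan-continue i (λ le → ¬le (subst (_≤⁺ _) (sym (𝐅≡ h i)) le)) best≡)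
            refl (write-here _ 𝐆 h i _) (λ ne → write-elsewhere _ 𝐆 h i _ ne) refl refl refl)
        where
        open ScanInv inv
        open TransformFrame frame

    backward-spec : ∀ μ₀ → After (backwardScan h) μ₀ (Backward.ScanInv μ₀ (reverse (reverse (allFin N))))
    backward-spec μ₀ = seq $ seq $ assign $ seq $ assign $ assign $
      loop (allPairs-reverse (allFin-sorted N)) ScanInv step record
        { frame = record
          { 𝐅≡ = λ _ _ → refl ; 𝐆≡ = λ _ _ → refl ; epochL≡ = λ _ → refl ; epochU≡ = λ _ → refl }
        ; best≡ = glb-∅ λ ()
        ; row   = λ ()
        ; fresh = λ _ → refl
        }
      where
      open Backward μ₀
      step : ∀ {done i μ} → Stage Fin._>_ (reverse (allFin N)) done i → ScanInv done μ →
             After _ μ (ScanInv (i ∷ done))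
      step {done} {i} {μ} st inv = seq $ assign $ seq $ branch
        (λ le → seq $ assign $ assign $ seq $ assign $ seq $ assign $ assign $
          update (λ x → Any.reverse⁺ (∈-allFin x)) st inv
            (subst (ScanGlb (i ∷ done) i) (sym i≡) (scan-restart i (subst (_≤⁺ _) i≡ le) best≡))
            refl (write-here _ 𝐆 h i _) (λ ne → write-elsewhere _ 𝐆 h i _ ne) refl refl refl)
        (λ ¬le → skip-rule $ seq $ assign $ seq $ assign $ assign $
          update (λ x → Any.reverse⁺ (∈-allFin x)) st inv
            (scan-continue i (λ le → ¬le (subst (_≤⁺ _) (sym i≡) le)) best≡)
            refl (write-here _ 𝐆 h i _) (λ ne → write-elsewhere _ 𝐆 h i _ ne) refl refl refl)
        where
        open ScanInv inv
        open TransformFrame frame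
        i≡ : μ 𝐆 h i ≡ μ₀ 𝐆 h i
        i≡ = fresh λ i∈ → ℕ.<-irrefl refl (proj₂ (Stage.past st i∈))

    transform-spec : ∀ μ₀ → After (transform h) μ₀ λ μ → TransformFrame h μ₀ μ × Transformed h μ
    transform-spec μ₀ = forward-spec μ₀ » λ {μ₁} inv₁ → consequence (finish inv₁) (backward-spec μ₁)
      where
      finish : ∀ {μ₁ μ} → Forward.ScanInv μ₀ (reverse (allFin N)) μ₁ →
               Backward.ScanInv μ₁ (reverse (reverse (allFin N))) μ →
               TransformFrame h μ₀ μ × Transformed h μ
      finish {μ₁} {μ} inv₁ inv₂ = record
        { 𝐅≡      = λ r z → trans (Fr₂.𝐅≡ r z) (Fr₁.𝐅≡ r z)
        ; 𝐆≡      = λ z r≢h → trans (Fr₂.𝐆≡ z r≢h) (Fr₁.𝐆≡ z r≢h)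
        ; epochL≡ = λ e → trans (Fr₂.epochL≡ e) (Fr₁.epochL≡ e)
        ; epochU≡ = λ e → trans (Fr₂.epochU≡ e) (Fr₁.epochU≡ e)
        } , λ x → glb-resp (λ p → p) (λ p → p)
                    (λ {y} _ → cong (_⊕ d y x) (sym (trans (Fr₂.𝐅≡ h y) (Fr₁.𝐅≡ h y))))
                    ((λ {y} _ → lower x y) , greatest x)
        where
        module Inv₁ = Forward.ScanInv μ₀ inv₁
        module Inv₂ = Backward.ScanInv μ₁ inv₂
        module Fr₁ = TransformFrame Inv₁.frame
        module Fr₂ = TransformFrame Inv₂.frame
        f = μ₀ 𝐅 h
        row₁ = λ x → Inv₁.row {x} (Any.reverse⁺ (∈-allFin x))
        row₂ = λ x → Inv₂.row {x} (Any.reverse⁺ (Any.reverse⁺ (∈-allFin x)))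
        via : ∀ {x w y} → w ≡ x ⊎ w Fin.> x → y ≡ w ⊎ y Fin.< w →
              μ 𝐆 h x ≤⁺ f y ⊕ ((site w - site y) + (site w - site x))
        via {x} {w} {y} w≥x y≤w = ≤⁺-trans (proj₁ (row₂ x) w≥x)
          (≤⁺-trans (⊕-mono-≤ (proj₁ (row₁ w) y≤w) ≤-refl) (≤⁺-reflexive (⊕-assoc (f y) _ _)))
        lower : ∀ x y → μ 𝐆 h x ≤⁺ f y ⊕ d y x
        lower x y with ℕ.≤-total (toℕ y) (toℕ x)
        ... | inj₁ y≤x = ≤⁺-trans (via (inj₁ refl) (≤⇒≡⊎< y≤x))
          (⊕-mono-≤ ≤⁺-refl (≤-trans
            (≤-reflexive (solve 2 (λ x y → (x :- y) :+ (x :- x) ⊜ :- (y :- x)) refl (site x) (site y)))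
            (-x≤∣x∣ (site y - site x))))
        ... | inj₂ x≤y = ≤⁺-trans (via (Sum.map₁ sym (≤⇒≡⊎< x≤y)) (inj₁ refl))
          (⊕-mono-≤ ≤⁺-refl (≤-trans
            (≤-reflexive (solve 2 (λ x y → (y :- y) :+ (y :- x) ⊜ y :- x) refl (site x) (site y)))
            (x≤∣x∣ (site y - site x))))
        site-≤ : ∀ {i k} → i ≡ k ⊎ i Fin.< k → site i ≤ site k
        site-≤ (inj₁ refl) = ≤-refl
        site-≤ (inj₂ i<k)  = site-mono-≤ i<k
        greatest : ∀ x b → (∀ {y} → ⊤ → b ≤⁺ f y ⊕ d y x) → b ≤⁺ μ 𝐆 h x
        greatest x b b≤ = proj₂ (row₂ x) b λ {w} w≥x →
          proj₂ (glb-⊕ (site w - site x) (row₁ w)) b λ {y} y≤w →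
            ≤⁺-trans (b≤ {y} tt) (≤⁺-trans
              (⊕-mono-≤ ≤⁺-refl (≤-trans (∣x-z∣-triangle (site y) (site w) (site x))
                (+-mono-≤ (≤-reflexive (x≤y⇒∣x-y∣≡y-x (site-≤ y≤w)))
                          (≤-reflexive (trans (∣x-y∣-sym (site w) (site x)) (x≤y⇒∣x-y∣≡y-x (site-≤ (Sum.map₁ sym w≥x))))))))
              (≤⁺-reflexive (sym (⊕-assoc (f y) _ _))))

-- Correctness of the implementation

module Extremal {R : OrderedField} {S : Shape} (I : Input R S) where
  open OrderedField R
  open OrderedFieldProperties R
  open Shape S
  open Model I
  open Kernel I

  module Extreme (_≼_ : Carrier → Carrier → Set) (≼-refl : ∀ {a} → a ≼ a)
                 (≼-trans : ∀ {a b c} → a ≼ b → b ≼ c → a ≼ c)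
                 (≼-antisym : ∀ {a b} → a ≼ b → b ≼ a → a ≡ b) where

    IsExtreme : (Request → Set) → Carrier → Set
    IsExtreme P x = (∃[ q ] P q × x ≡ siteOf q) × (∀ {q} → P q → x ≼ siteOf q)

    resp : ∀ {P P′ x} → (∀ {q} → P q → P′ q) → (∀ {q} → P′ q → P q) → IsExtreme P x → IsExtreme P′ x
    resp P⊆P′ P′⊆P ((q , Pq , eq) , x≼) = (q , P⊆P′ Pq , eq) , x≼ ∘ P′⊆P

    ∪ˡ : ∀ {P Q x y} → x ≼ y → IsExtreme P x → IsExtreme Q y → IsExtreme (λ q → P q ⊎ Q q) x
    ∪ˡ x≼y ((q , Pq , eq) , x≼) (_ , y≼) =
      (q , inj₁ Pq , eq) , λ { (inj₁ Pq) → x≼ Pq ; (inj₂ Qq) → ≼-trans x≼y (y≼ Qq) }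

    ∪ʳ : ∀ {P Q x y} → y ≼ x → IsExtreme P x → IsExtreme Q y → IsExtreme (λ q → P q ⊎ Q q) y
    ∪ʳ y≼x hx hy = resp Sum.swap Sum.swap (∪ˡ y≼x hy hx)

    unique : ∀ {P x y} → IsExtreme P x → IsExtreme P y → x ≡ y
    unique ((q , Pq , refl) , x≼) ((r , Pr , refl) , y≼) = ≼-antisym (x≼ Pr) (y≼ Pq)

    singleton : ∀ q → IsExtreme (_≡ q) (siteOf q)
    singleton q = (q , refl , refl) , λ { refl → ≼-refl }

  module Leftmost  = Extreme _≤_ ≤-refl ≤-trans ≤-antisym
  module Rightmost = Extreme (flip _≤_) ≤-refl (flip ≤-trans) (flip ≤-antisym)

  IsLeftmost IsRightmost : (Request → Set) → Carrier → Set
  IsLeftmost  = Leftmost.IsExtreme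
  IsRightmost = Rightmost.IsExtreme

  L-leftmost : ∀ {p j} → p Fin.≤ j → IsLeftmost (InRange p j) (L p j)
  L-leftmost p≤j = L-attained p≤j , L-≤

  U-rightmost : ∀ {p j} → p Fin.≤ j → IsRightmost (InRange p j) (U p j)
  U-rightmost p≤j = U-attained p≤j , ≤-U

module Initialisation {R : OrderedField} {S : Shape} (I : Input R S) where
  open OrderedField R
  open OrderedFieldProperties R
  open Glb R
  open Shape S
  open Input I
  open Model I using (loc)
  open Kernel I using (siteOf)
  open Extremal I
  open DistanceTransform S
  open Syntax S layout
  open Semantics I layout
  open Hoare I layout

  record EpochsKnown (μ : Store) : Set where
    field
      leftmost  : ∀ h → IsLeftmost  (λ q → proj₁ q ≡ h) (site (μ epochL zero h))
      rightmost : ∀ h → IsRightmost (λ q → proj₁ q ≡ h) (site (μ epochU zero h))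

  module _ (h : Fin m) (μ₀ : Store) where

    Seen : List (Fin (size h)) → Request → Set
    Seen done q = q ≡ (h , first h) ⊎ (∃[ i ] i ∈ done × q ≡ (h , i))

    record EpochInv (doneL doneU : List (Fin (size h))) (μ : Store) : Set where
      field
        left   : IsLeftmost  (Seen doneL) (site (μ epochL zero h))
        right  : IsRightmost (Seen doneU) (site (μ epochU zero h))
        otherL : ∀ {e} → e ≢ h → μ epochL zero e ≡ μ₀ epochL zero e
        otherU : ∀ {e} → e ≢ h → μ epochU zero e ≡ μ₀ epochU zero e

    seen⁺ : ∀ {done i q} → Seen done q ⊎ q ≡ (h , i) → Seen (i ∷ done) q
    seen⁺ (inj₁ (inj₁ eq))             = inj₁ eq
    seen⁺ (inj₁ (inj₂ (i , i∈ , eq)))  = inj₂ (i , there i∈ , eq)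
    seen⁺ (inj₂ eq)                    = inj₂ (_ , here refl , eq)

    seen⁻ : ∀ {done i q} → Seen (i ∷ done) q → Seen done q ⊎ q ≡ (h , i)
    seen⁻ (inj₁ eq)                       = inj₁ (inj₁ eq)
    seen⁻ (inj₂ (_ , here refl , eq))     = inj₂ eq
    seen⁻ (inj₂ (i , there i∈ , eq))      = inj₁ (inj₂ (i , i∈ , eq))

    seen-[] : ∀ {q} → q ≡ (h , first h) → Seen [] q
    seen-[] = inj₁

    seen-[]⁻ : ∀ {q} → Seen [] q → q ≡ (h , first h)
    seen-[]⁻ (inj₁ eq) = eq

    seen-all : ∀ {done q} → (∀ i → i ∈ done) → proj₁ q ≡ h → Seen done q
    seen-all {q = _ , i} all refl = inj₂ (i , all i , refl)

    seen-epoch : ∀ {done q} → Seen done q → proj₁ q ≡ h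
    seen-epoch (inj₁ refl)           = refl
    seen-epoch (inj₂ (_ , _ , refl)) = refl

    epoch-spec : ∀ {P : Store → Set} → (∀ {done μ} → (∀ i → i ∈ done) → EpochInv done done μ → P μ) →
      After (epochL ⟨ o , at h ⟩≔ locationOf h (first h) ⨾
             epochU ⟨ o , at h ⟩≔ locationOf h (first h) ⨾
             for (allFin (size h)) λ i →
               (if siteAt (epochL ⟨ o , at h ⟩) `≤ siteAt (locationOf h i)
                  then skip else (epochL ⟨ o , at h ⟩≔ locationOf h i)) ⨾
               (if siteAt (locationOf h i) `≤ siteAt (epochU ⟨ o , at h ⟩)
                  then skip else (epochU ⟨ o , at h ⟩≔ locationOf h i))) μ₀ P
    epoch-spec finish = seq $ assign $ seq $ assign $
      consequence (finish λ i → Any.reverse⁺ (∈-allFin i))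
        (loop (allFin-sorted (size h)) (λ done → EpochInv done done) (λ _ inv → stepL inv » stepU) record
          { left   = subst (IsLeftmost (Seen []) ∘ site) (sym (write-here _ epochL zero h (location h (first h))))
                       (Leftmost.resp seen-[] seen-[]⁻ (Leftmost.singleton (h , first h)))
          ; right  = subst (IsRightmost (Seen []) ∘ site) (sym (write-here _ epochU zero h (location h (first h))))
                       (Rightmost.resp seen-[] seen-[]⁻ (Rightmost.singleton (h , first h)))
          ; otherL = λ e≢h → write-elsewhere _ epochL zero h (location h (first h)) {zero} λ (_ , h≡e) → e≢h (sym h≡e)
          ; otherU = λ e≢h → write-elsewhere _ epochU zero h (location h (first h)) {zero} λ (_ , h≡e) → e≢h (sym h≡e)
          })
      where
      stepL : ∀ {done i μ} → EpochInv done done μ → After _ μ (EpochInv (i ∷ done) done)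
      stepL {done} {i} {μ} inv = branch
        (λ le → skip-rule record
          { left = Leftmost.resp seen⁺ seen⁻ (Leftmost.∪ˡ le left (Leftmost.singleton (h , i)))
          ; right = right ; otherL = otherL ; otherU = otherU })
        (λ ¬le → assign record
          { left   = subst (IsLeftmost (Seen (i ∷ done)) ∘ site) (sym (write-here μ epochL zero h (location h i)))
                       (Leftmost.resp seen⁺ seen⁻ (Leftmost.∪ʳ (≰⇒≥ ¬le) left (Leftmost.singleton (h , i))))
          ; right  = right
          ; otherL = λ e≢h → trans (write-elsewhere μ epochL zero h (location h i) λ (_ , h≡e) → e≢h (sym h≡e))
                                  (otherL e≢h)
          ; otherU = otherU })
        where open EpochInv inv
      stepU : ∀ {done i μ} → EpochInv (i ∷ done) done μ → After _ μ (EpochInv (i ∷ done) (i ∷ done))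
      stepU {done} {i} {μ} inv = branch
        (λ le → skip-rule record
          { right = Rightmost.resp seen⁺ seen⁻ (Rightmost.∪ˡ le right (Rightmost.singleton (h , i)))
          ; left = left ; otherL = otherL ; otherU = otherU })
        (λ ¬le → assign record
          { right  = subst (IsRightmost (Seen (i ∷ done)) ∘ site) (sym (write-here μ epochU zero h (location h i)))
                       (Rightmost.resp seen⁺ seen⁻ (Rightmost.∪ʳ (≰⇒≥ ¬le) right (Rightmost.singleton (h , i))))
          ; left   = left
          ; otherU = λ e≢h → trans (write-elsewhere μ epochU zero h (location h i) λ (_ , h≡e) → e≢h (sym h≡e))
                                  (otherU e≢h)
          ; otherL = otherL })
        where open EpochInv inv

  epochExtrema-spec : ∀ μ₀ → After epochExtrema μ₀ EpochsKnown
  epochExtrema-spec μ₀ = consequence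
    (λ inv → record { leftmost = λ h → proj₁ (inv (Any.reverse⁺ (∈-allFin h)))
                    ; rightmost = λ h → proj₂ (inv (Any.reverse⁺ (∈-allFin h))) })
    (loop (allFin-sorted m) Inv step λ ())
    where
    Inv : List (Fin m) → Store → Set
    Inv done μ = ∀ {h} → h ∈ done → IsLeftmost  (λ q → proj₁ q ≡ h) (site (μ epochL zero h)) ×
                                    IsRightmost (λ q → proj₁ q ≡ h) (site (μ epochU zero h))
    extend : ∀ {done h μ₀ μ is} → Stage Fin._<_ (allFin m) done h → Inv done μ₀ →
             (∀ i → i ∈ is) → EpochInv h μ₀ is is μ → Inv (h ∷ done) μ
    extend {h = h} {μ₀} st inv all new (here refl) =
      Leftmost.resp (seen-epoch h μ₀) (seen-all h μ₀ all) (EpochInv.left new) ,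
      Rightmost.resp (seen-epoch h μ₀) (seen-all h μ₀ all) (EpochInv.right new)
    extend {h = h} st inv all new {e} (there e∈) =
      subst (IsLeftmost _ ∘ site) (sym (EpochInv.otherL new e≢h)) (proj₁ (inv e∈)) ,
      subst (IsRightmost _ ∘ site) (sym (EpochInv.otherU new e≢h)) (proj₂ (inv e∈))
      where
      e≢h : e ≢ h
      e≢h refl = ℕ.<-irrefl refl (proj₂ (Stage.past st e∈))
    step : ∀ {done h μ} → Stage Fin._<_ (allFin m) done h → Inv done μ → After _ μ (Inv (h ∷ done))
    step {done} {h} {μ} st inv = epoch-spec h μ (extend st inv)

  record LayerFrame (r : Fin (suc m)) (μ₀ μ : Store) : Set where
    field
      𝐅≡      : ∀ {r′} z → r′ ≢ r → μ 𝐅 r′ z ≡ μ₀ 𝐅 r′ z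
      𝐆≡      : ∀ {r′} z → r′ ≢ r → μ 𝐆 r′ z ≡ μ₀ 𝐆 r′ z
      epochL≡ : ∀ e → μ epochL zero e ≡ μ₀ epochL zero e
      epochU≡ : ∀ e → μ epochU zero e ≡ μ₀ epochU zero e

  layerFrame-trans : ∀ {r μ₀ μ₁ μ₂} → LayerFrame r μ₀ μ₁ → LayerFrame r μ₁ μ₂ → LayerFrame r μ₀ μ₂
  layerFrame-trans f g = record
    { 𝐅≡      = λ z ne → trans (G.𝐅≡ z ne) (F.𝐅≡ z ne)
    ; 𝐆≡      = λ z ne → trans (G.𝐆≡ z ne) (F.𝐆≡ z ne)
    ; epochL≡ = λ e → trans (G.epochL≡ e) (F.epochL≡ e)
    ; epochU≡ = λ e → trans (G.epochU≡ e) (F.epochU≡ e)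
    }
    where
    module F = LayerFrame f
    module G = LayerFrame g

  epochsKnown-frame : ∀ {r μ₀ μ} → LayerFrame r μ₀ μ → EpochsKnown μ₀ → EpochsKnown μ
  epochsKnown-frame f k = record
    { leftmost  = λ h → subst (IsLeftmost _ ∘ site) (sym (LayerFrame.epochL≡ f h)) (EpochsKnown.leftmost k h)
    ; rightmost = λ h → subst (IsRightmost _ ∘ site) (sym (LayerFrame.epochU≡ f h)) (EpochsKnown.rightmost k h)
    }

  clear-spec : ∀ r μ₀ → After (for (allFin N) λ z → 𝐅 ⟨ at r , at z ⟩≔ `∞) μ₀
                 λ μ → LayerFrame r μ₀ μ × (∀ z → μ 𝐅 r z ≡ ⊤⁺)
  clear-spec r μ₀ = consequence (λ (f , h) → f , λ z → h (Any.reverse⁺ (∈-allFin z)))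
    (loop (allFin-sorted N) Inv (λ _ inv → assign (step inv))
      (record { 𝐅≡ = λ _ _ → refl ; 𝐆≡ = λ _ _ → refl ; epochL≡ = λ _ → refl ; epochU≡ = λ _ → refl } , λ ()))
    where
    Inv : List (Fin N) → Store → Set
    Inv done μ = LayerFrame r μ₀ μ × (∀ {z} → z ∈ done → μ 𝐅 r z ≡ ⊤⁺)
    step : ∀ {done i μ} → Inv done μ → Inv (i ∷ done) (write μ 𝐅 r i ⊤⁺)
    step {done} {i} {μ} (f , h) = record
      { 𝐅≡      = λ z ne → trans (write-elsewhere μ 𝐅 r i ⊤⁺ λ (r≡ , _) → ne (sym r≡)) (𝐅≡ z ne)
      ; 𝐆≡      = 𝐆≡
      ; epochL≡ = epochL≡
      ; epochU≡ = epochU≡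
      } , cleared
      where
      open LayerFrame f
      cleared : ∀ {z} → z ∈ i ∷ done → write μ 𝐅 r i ⊤⁺ 𝐅 r z ≡ ⊤⁺
      cleared (here refl) = write-here μ 𝐅 r i ⊤⁺
      cleared {z} (there z∈) = cases (i Fin.≟ z)
        where
        cases : Dec (i ≡ z) → write μ 𝐅 r i ⊤⁺ 𝐅 r z ≡ ⊤⁺
        cases (yes refl) = write-here μ 𝐅 r i ⊤⁺
        cases (no  i≢z)  = trans (write-elsewhere μ 𝐅 r i ⊤⁺ λ (_ , i≡z) → i≢z i≡z) (h z∈)

  record InitialRow (μ : Store) : Set where
    field
      start : μ 𝐅 zero s₀ ≡ [ 0# ]
      other : ∀ z → z ≢ s₀ → μ 𝐅 zero z ≡ ⊤⁺

  initialLayer-spec : ∀ μ₀ → After initialLayer μ₀ λ μ → LayerFrame zero μ₀ μ × InitialRow μ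
  initialLayer-spec μ₀ = clear-spec zero μ₀ » λ (f , h) → assign (set-start f h)
    where
    set-start : ∀ {μ} → LayerFrame zero μ₀ μ → (∀ z → μ 𝐅 zero z ≡ ⊤⁺) →
                LayerFrame zero μ₀ (write μ 𝐅 zero s₀ [ 0# ]) × InitialRow (write μ 𝐅 zero s₀ [ 0# ])
    set-start {μ} f h = record
      { 𝐅≡      = λ z ne → trans (write-elsewhere μ 𝐅 zero s₀ [ 0# ] λ (r≡ , _) → ne (sym r≡)) (𝐅≡ z ne)
      ; 𝐆≡      = 𝐆≡
      ; epochL≡ = epochL≡
      ; epochU≡ = epochU≡
      } ,
      record
      { start = write-here μ 𝐅 zero s₀ [ 0# ]
      ; other = λ z z≢s₀ → trans (write-elsewhere μ 𝐅 zero s₀ [ 0# ] λ (_ , s₀≡z) → z≢s₀ (sym s₀≡z)) (h z)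
      }
      where open LayerFrame f

module Layers {R : OrderedField} {S : Shape} (I : Input R S) where
  open OrderedField R
  open OrderedFieldProperties R
  open Glb R
  open Shape S
  open Input I
  open Model I using (d; L; U; K; Table; IsTable)
  open Kernel I using (siteOf; InRange)
  open Extremal I
  open DistanceTransform S
  open Syntax S layout
  open Semantics I layout
  open Hoare I layout
  open Transform I using (TransformFrame; module TransformFrame; Transformed; transform-spec)
  open Initialisation I using
    (EpochsKnown; module EpochsKnown; epochsKnown-frame; LayerFrame; module LayerFrame; layerFrame-trans;
     clear-spec; InitialRow; module InitialRow; initialLayer-spec; epochExtrema-spec)

  glb-min : ∀ {A : Set} {P : A → Set} {f g h : A → Carrier⁺} {u v} → u ≤⁺ v → IsGlb P f u → IsGlb P g v →
            (∀ x → h x ≤⁺ f x) → (∀ x → f x ≤⁺ h x ⊎ g x ≤⁺ h x) → IsGlb P h u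
  glb-min {P = P} {f} {g} {h} {u} u≤v (u≤f , f≤u) (v≤g , _) h≤f f⊎g≤h =
    (λ {x} Px → below Px (f⊎g≤h x)) ,
    λ b b≤h → f≤u b λ {x} Px → ≤⁺-trans (b≤h Px) (h≤f x)
    where
    below : ∀ {x} → P x → f x ≤⁺ h x ⊎ g x ≤⁺ h x → u ≤⁺ h x
    below Px (inj₁ f≤h) = ≤⁺-trans (u≤f Px) f≤h
    below Px (inj₂ g≤h) = ≤⁺-trans u≤v (≤⁺-trans (v≤g Px) g≤h)

  module Candidate (p j : Fin m) (f g : Fin N → Carrier⁺)
                   (g-glb : ∀ x → IsGlb (λ _ → ⊤) (λ y → f y ⊕ d y x) (g x))
                   (l u : Fin N) (l≡ : site l ≡ L p j) (u≡ : site u ≡ U p j) (z : Fin N)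
                   (b : Carrier) (b≡ : b ≡ (U p j - L p j) + (arrival j - arrival p)) where

    Δ = arrival j - arrival p
    left  = g l ⊕ ∣ site u - site z ∣
    right = g u ⊕ ∣ site l - site z ∣
    α β : Fin N → Carrier
    α y = ∣ site y - L p j ∣ + ∣ U p j - site z ∣
    β y = ∣ site y - U p j ∣ + ∣ L p j - site z ∣

    value : Fin N → Carrier⁺
    value y = f y ⊕ K p j y z ⊕ Δ

    left-glb : IsGlb (λ _ → ⊤) (λ y → f y ⊕ (α y + b)) (left ⊕ b)
    left-glb = glb-resp (λ t → t) (λ t → t)
      (λ {y} _ → trans (⊕-assoc _ _ _) (trans (⊕-assoc (f y) _ _)
        (cong (f y ⊕_) (trans (sym (+-assoc _ _ _))
          (cong₂ (λ v w → ∣ site y - v ∣ + ∣ w - site z ∣ + b) l≡ u≡)))))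
      (glb-⊕ b (glb-⊕ _ (g-glb l)))

    right-glb : IsGlb (λ _ → ⊤) (λ y → f y ⊕ (β y + b)) (right ⊕ b)
    right-glb = glb-resp (λ t → t) (λ t → t)
      (λ {y} _ → trans (⊕-assoc _ _ _) (trans (⊕-assoc (f y) _ _)
        (cong (f y ⊕_) (trans (sym (+-assoc _ _ _))
          (cong₂ (λ v w → ∣ site y - v ∣ + ∣ w - site z ∣ + b) u≡ l≡)))))
      (glb-⊕ b (glb-⊕ _ (g-glb u)))

    value≡ : ∀ y → value y ≡ f y ⊕ ((α y ⊓ β y) + b)
    value≡ y = trans (⊕-assoc (f y) _ _) (cong (f y ⊕_)
      (trans (solve 3 (λ w k δ → (w :+ k) :+ δ ⊜ k :+ (w :+ δ)) refl (U p j - L p j) (α y ⊓ β y) Δ)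
             (cong ((α y ⊓ β y) +_) (sym b≡))))

    value≤ : ∀ {y c} → α y ⊓ β y ≤ c → value y ≤⁺ f y ⊕ (c + b)
    value≤ {y} h = ≤⁺-trans (≤⁺-reflexive (value≡ y)) (⊕-mono-≤ ≤⁺-refl (+-mono-≤ h ≤-refl))

    ≤value : ∀ {y c} → c ≤ α y ⊓ β y → f y ⊕ (c + b) ≤⁺ value y
    ≤value {y} h = ≤⁺-trans (⊕-mono-≤ ≤⁺-refl (+-mono-≤ h ≤-refl)) (≤⁺-reflexive (sym (value≡ y)))

    attained : ∀ y → f y ⊕ (α y + b) ≤⁺ value y ⊎ f y ⊕ (β y + b) ≤⁺ value y
    attained y = Sum.map (λ α≤β → ≤value (⊓-glb ≤-refl α≤β)) (λ β≤α → ≤value (⊓-glb β≤α ≤-refl))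
      (≤-total (α y) (β y))

    choose-left : left ≤⁺ right → IsGlb (λ _ → ⊤) value (left ⊕ b)
    choose-left le = glb-min (⊕-mono-≤ le ≤-refl) left-glb right-glb
      (λ y → value≤ (x⊓y≤x (α y) (β y))) attained

    choose-right : ¬ left ≤⁺ right → IsGlb (λ _ → ⊤) value (right ⊕ b)
    choose-right ¬le = glb-min (⊕-mono-≤ (≰⁺⇒≥⁺ ¬le) ≤-refl) right-glb left-glb
      (λ y → value≤ (x⊓y≤y (α y) (β y))) (Sum.swap ∘ attained)

  candidate : Store → (j : Fin m) → Fin N → Fin m × Fin N → Carrier⁺
  candidate μ j z (p , y) = μ 𝐅 (inject₁ p) y ⊕ K p j y z ⊕ (arrival j - arrival p)

  Row : Fin m → Store → Set
  Row j μ = ∀ z → IsGlb (λ (p , _) → p Fin.≤ j) (candidate μ j z) (μ 𝐅 (suc j) z)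

  inject₁≢suc : ∀ {p j : Fin m} → p Fin.≤ j → inject₁ p ≢ suc j
  inject₁≢suc {p} {j} p≤j eq = ℕ.<-irrefl (trans (sym (Fin.toℕ-inject₁ p)) (cong toℕ eq)) (ℕ.s≤s p≤j)

  module Layer (j : Fin m) (μ₀ : Store) (known : EpochsKnown μ₀)
               (transformed : ∀ {p} → p Fin.≤ j → Transformed (inject₁ p) μ₀) where

    Seen : List (Fin m) → Fin m → Set
    Seen done h = h ≡ j ⊎ h ∈ done

    RowGlb : List (Fin m) → Fin N → Carrier⁺ → Set
    RowGlb done z = IsGlb (λ (p , _) → p ∈ done) (candidate μ₀ j z)

    record BlockInv (doneL doneU done : List (Fin m)) (μ : Store) : Set where
      field
        frame : LayerFrame (suc j) μ₀ μ
        left  : IsLeftmost  (λ q → Seen doneL (proj₁ q)) (site (μ curL zero zero))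
        right : IsRightmost (λ q → Seen doneU (proj₁ q)) (site (μ curU zero zero))
        rows  : ∀ z → RowGlb done z (μ 𝐅 (suc j) z)

    seen⁺ : ∀ {done p h} → Seen done h ⊎ h ≡ p → Seen (p ∷ done) h
    seen⁺ (inj₁ (inj₁ h≡j)) = inj₁ h≡j
    seen⁺ (inj₁ (inj₂ h∈))  = inj₂ (there h∈)
    seen⁺ (inj₂ h≡p)        = inj₂ (here h≡p)

    seen⁻ : ∀ {done p h} → Seen (p ∷ done) h → Seen done h ⊎ h ≡ p
    seen⁻ (inj₁ h≡j)         = inj₁ (inj₁ h≡j)
    seen⁻ (inj₂ (here h≡p))  = inj₂ h≡p
    seen⁻ (inj₂ (there h∈))  = inj₁ (inj₂ h∈)

    widen-spec : ∀ {p done μ} → BlockInv done done done μ →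
                 After (widen p) μ (BlockInv (p ∷ done) (p ∷ done) done)
    widen-spec {p} {done} inv = stepL inv » stepU
      where
      epochL′ : ∀ {μ} → LayerFrame (suc j) μ₀ μ → IsLeftmost (λ q → proj₁ q ≡ p) (site (μ epochL zero p))
      epochL′ f = EpochsKnown.leftmost (epochsKnown-frame f known) p
      epochU′ : ∀ {μ} → LayerFrame (suc j) μ₀ μ → IsRightmost (λ q → proj₁ q ≡ p) (site (μ epochU zero p))
      epochU′ f = EpochsKnown.rightmost (epochsKnown-frame f known) p
      stepL : ∀ {μ} → BlockInv done done done μ → After _ μ (BlockInv (p ∷ done) done done)
      stepL inv = branch
        (λ le → skip-rule record
          { frame = frame ; left = Leftmost.resp seen⁺ seen⁻ (Leftmost.∪ˡ le left (epochL′ frame))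
          ; right = right ; rows = rows })
        (λ ¬le → assign record
          { frame = record { LayerFrame frame }
          ; left = Leftmost.resp seen⁺ seen⁻ (Leftmost.∪ʳ (≰⇒≥ ¬le) left (epochL′ frame))
          ; right = right ; rows = rows })
        where open BlockInv inv
      stepU : ∀ {μ} → BlockInv (p ∷ done) done done μ → After _ μ (BlockInv (p ∷ done) (p ∷ done) done)
      stepU inv = branch
        (λ le → skip-rule record
          { frame = frame ; right = Rightmost.resp seen⁺ seen⁻ (Rightmost.∪ˡ le right (epochU′ frame))
          ; left = left ; rows = rows })
        (λ ¬le → assign record
          { frame = record { LayerFrame frame }
          ; right = Rightmost.resp seen⁺ seen⁻ (Rightmost.∪ʳ (≰⇒≥ ¬le) right (epochU′ frame))
          ; left = left ; rows = rows })
        where open BlockInv inv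

    module Relax (p : Fin m) (p≤j : p Fin.≤ j) (done : List (Fin m)) where

      record RelaxInv (relaxed : List (Fin N)) (μ : Store) : Set where
        field
          frame   : LayerFrame (suc j) μ₀ μ
          left≡   : site (μ curL zero zero) ≡ L p j
          right≡  : site (μ curU zero zero) ≡ U p j
          base≡   : μ base zero zero ≡ (U p j - L p j) + (arrival j - arrival p)
          new     : ∀ {z} → z ∈ relaxed → RowGlb (p ∷ done) z (μ 𝐅 (suc j) z)
          old     : ∀ {z} → z ∉ relaxed → RowGlb done z (μ 𝐅 (suc j) z)

      Chosen : Fin N → Carrier⁺ → Set
      Chosen z = IsGlb (λ _ → ⊤) (λ y → candidate μ₀ j z (p , y))

      row⁺ : ∀ {z c v} → c ≤⁺ v → Chosen z c → RowGlb done z v → RowGlb (p ∷ done) z c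
      row⁺ c≤v chosen old =
        (λ { (here refl) → proj₁ chosen tt ; (there p∈) → ≤⁺-trans c≤v (proj₁ old p∈) }) ,
        λ b b≤ → proj₂ chosen b λ _ → b≤ (here refl)

      row⁰ : ∀ {z c v} → v ≤⁺ c → Chosen z c → RowGlb done z v → RowGlb (p ∷ done) z v
      row⁰ v≤c chosen old =
        (λ { (here refl) → ≤⁺-trans v≤c (proj₁ chosen tt) ; (there p∈) → proj₁ old p∈ }) ,
        λ b b≤ → proj₂ old b λ p∈ → b≤ (there p∈)

      relax-spec : ∀ {relaxed z μ} → z ∉ relaxed → RelaxInv relaxed μ →
                   After (relax j p z) μ (RelaxInv (z ∷ relaxed))
      relax-spec {relaxed} {z} {μ} z∉ inv = choose » λ (inv , chosen) → seq $ assign $ update inv chosen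
        where
        Mid : Store → Set
        Mid μ′ = RelaxInv relaxed μ′ × Chosen z (μ′ cand zero zero ⊕ μ′ base zero zero)
        choose : After _ μ Mid
        choose = branch
          (λ le → seq $ assign $ seq $ assign $ assign $
            record { frame = record { LayerFrame frame } ; left≡ = left≡ ; right≡ = right≡
                   ; base≡ = base≡ ; new = new ; old = old } ,
            C.choose-left le)
          (λ ¬le → seq $ assign $ seq $ assign $ assign $
            record { frame = record { LayerFrame frame } ; left≡ = left≡ ; right≡ = right≡
                   ; base≡ = base≡ ; new = new ; old = old } ,
            C.choose-right ¬le)
          where
          open RelaxInv inv
          module C = Candidate p j (μ₀ 𝐅 (inject₁ p)) (μ 𝐆 (inject₁ p))
            (λ x → subst (IsGlb (λ _ → ⊤) (λ y → μ₀ 𝐅 (inject₁ p) y ⊕ d y x))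
                         (sym (LayerFrame.𝐆≡ frame x (inject₁≢suc p≤j))) (transformed p≤j x))
            (μ curL zero zero) (μ curU zero zero) left≡ right≡ z (μ base zero zero) base≡
        update : ∀ {μ} → RelaxInv relaxed μ → Chosen z (μ cand zero zero ⊕ μ base zero zero) →
                 After _ (write μ cand zero zero (μ cand zero zero ⊕ μ base zero zero)) (RelaxInv (z ∷ relaxed))
        update {μ} inv chosen = branch
          (λ le → skip-rule record
            { frame = record { LayerFrame frame } ; left≡ = left≡ ; right≡ = right≡ ; base≡ = base≡
            ; new   = λ { (here refl) → row⁰ le chosen (old z∉) ; (there z∈) → new z∈ }
            ; old   = λ z∉ → old (z∉ ∘ there) })
          (λ ¬le → seq $ assign $ seq $ assign $ seq $ assign $ assign record
            { frame = record
              { 𝐅≡ = λ {r′} z′ r′≢ → trans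
                  (write-elsewhere _ 𝐅 (suc j) z _ {r′} {z′} λ (r≡ , _) → r′≢ (sym r≡))
                  (LayerFrame.𝐅≡ frame z′ r′≢)
              ; 𝐆≡ = LayerFrame.𝐆≡ frame
              ; epochL≡ = LayerFrame.epochL≡ frame ; epochU≡ = LayerFrame.epochU≡ frame }
            ; left≡ = left≡ ; right≡ = right≡ ; base≡ = base≡
            ; new   = λ { (here refl) → subst (RowGlb (p ∷ done) z) (sym (write-here _ 𝐅 (suc j) z _))
                                          (row⁺ (≰⁺⇒≥⁺ ¬le) chosen (old z∉))
                        ; {z′} (there z∈) → subst (RowGlb (p ∷ done) z′)
                                          (sym (write-elsewhere _ 𝐅 (suc j) z _ {suc j} {z′} λ { (_ , refl) → z∉ z∈ })) (new z∈) }
            ; old   = λ {z′} z′∉ → subst (RowGlb done z′)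
                (sym (write-elsewhere _ 𝐅 (suc j) z _ {suc j} {z′} λ { (_ , refl) → z′∉ (here refl) }))
                (old (z′∉ ∘ there))
            })
          where open RelaxInv inv

    sorted : AllPairs Fin._>_ (reverse (upTo j))
    sorted = allPairs-reverse (AllPairs.filter⁺ (Fin._≤? j) (allFin-sorted m))

    ∈-sorted⁺ : ∀ {p} → p Fin.≤ j → p ∈ reverse (upTo j)
    ∈-sorted⁺ {p} p≤j = Any.reverse⁺ (∈-filter⁺ (Fin._≤? j) (∈-allFin p) p≤j)

    ∈-sorted⁻ : ∀ {p} → p ∈ reverse (upTo j) → p Fin.≤ j
    ∈-sorted⁻ p∈ = proj₂ (∈-filter⁻ (Fin._≤? j) {xs = allFin m} (Any.reverse⁻ p∈))

    block-spec : ∀ {p done μ} → Stage Fin._>_ (reverse (upTo j)) done p → BlockInv done done done μ →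
      After (widen p ⨾
             base ⟨ o , o ⟩≔ (siteAt highSite `- siteAt lowSite) `+ (arrivalAt (at j) `- arrivalAt (at p)) ⨾
             for (allFin N) (relax j p)) μ (BlockInv (p ∷ done) (p ∷ done) (p ∷ done))
    block-spec {p} {done} st inv = widen-spec inv » λ inv → seq $ assign $
      consequence finish
        (loop (allFin-sorted N) RelaxInv
          (λ st inv → relax-spec (λ z∈ → ℕ.<-irrefl refl (proj₂ (Stage.past st z∈))) inv) (begin inv))
      where
      p≤j : p Fin.≤ j
      p≤j = ∈-sorted⁻ (Stage.current st)
      open Relax p p≤j done
      seen⇒inRange : ∀ {h} → Seen (p ∷ done) h → p Fin.≤ h × h Fin.≤ j
      seen⇒inRange (inj₁ refl)         = p≤j , Fin.≤-refl
      seen⇒inRange (inj₂ (here refl))  = Fin.≤-refl , p≤j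
      seen⇒inRange (inj₂ (there h∈)) with Stage.past st h∈
      ... | h∈xs , p<h = ℕ.<⇒≤ p<h , ∈-sorted⁻ h∈xs
      inRange⇒seen : ∀ {h} → p Fin.≤ h × h Fin.≤ j → Seen (p ∷ done) h
      inRange⇒seen (p≤h , h≤j) with Stage.future st (∈-sorted⁺ h≤j)
      ... | inj₁ h∈  = inj₂ h∈
      ... | inj₂ h<p = contradiction p≤h (ℕ.<⇒≱ h<p)
      begin : ∀ {μ} → BlockInv (p ∷ done) (p ∷ done) done μ →
              RelaxInv [] (write μ base zero zero ((site (μ curU zero zero) - site (μ curL zero zero))
                                                   + (arrival j - arrival p)))
      begin {μ} inv = record
        { frame  = record { LayerFrame frame }
        ; left≡  = left≡
        ; right≡ = right≡
        ; base≡  = cong₂ (λ u l → (u - l) + (arrival j - arrival p)) right≡ left≡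
        ; new    = λ ()
        ; old    = λ _ → rows _
        }
        where
        open BlockInv inv
        left≡ : site (μ curL zero zero) ≡ L p j
        left≡ = Leftmost.unique (Leftmost.resp seen⇒inRange inRange⇒seen left) (L-leftmost p≤j)
        right≡ : site (μ curU zero zero) ≡ U p j
        right≡ = Rightmost.unique (Rightmost.resp seen⇒inRange inRange⇒seen right) (U-rightmost p≤j)
      finish : ∀ {μ} → RelaxInv (reverse (allFin N)) μ → BlockInv (p ∷ done) (p ∷ done) (p ∷ done) μ
      finish inv = record
        { frame = frame
        ; left  = subst (IsLeftmost _) (sym left≡) (Leftmost.resp inRange⇒seen seen⇒inRange (L-leftmost p≤j))
        ; right = subst (IsRightmost _) (sym right≡) (Rightmost.resp inRange⇒seen seen⇒inRange (U-rightmost p≤j))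
        ; rows  = λ z → new (Any.reverse⁺ (∈-allFin z))
        }
        where open RelaxInv inv

    layer-spec : After (layer j) μ₀ λ μ → LayerFrame (suc j) μ₀ μ × Row j μ × Transformed (suc j) μ
    layer-spec = clear-spec (suc j) μ₀ » λ (frame , cleared) →
      seq $ assign $ seq $ assign $
      loop sorted (λ done → BlockInv done done done) block-spec (start frame cleared)
      » λ {μ₁} inv → consequence (λ (frame₂ , t) → finish inv frame₂ t) (transform-spec (suc j) μ₁)
      where
      start : ∀ {μ} → LayerFrame (suc j) μ₀ μ → (∀ z → μ 𝐅 (suc j) z ≡ ⊤⁺) →
              BlockInv [] [] [] (write (write μ curL zero zero (μ epochL zero j)) curU zero zero (μ epochU zero j))
      start frame cleared = record
        { frame = record { LayerFrame frame }
        ; left  = Leftmost.resp inj₁ (λ { (inj₁ h≡j) → h≡j ; (inj₂ ()) })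
                    (EpochsKnown.leftmost (epochsKnown-frame frame known) j)
        ; right = Rightmost.resp inj₁ (λ { (inj₁ h≡j) → h≡j ; (inj₂ ()) })
                    (EpochsKnown.rightmost (epochsKnown-frame frame known) j)
        ; rows  = λ z → subst (RowGlb [] z) (sym (cleared z)) (glb-∅ λ ())
        }
      finish : ∀ {μ₁ μ} → BlockInv (reverse (reverse (upTo j))) (reverse (reverse (upTo j)))
                 (reverse (reverse (upTo j))) μ₁ → TransformFrame (suc j) μ₁ μ → Transformed (suc j) μ →
               LayerFrame (suc j) μ₀ μ × Row j μ × Transformed (suc j) μ
      finish {μ₁} {μ} inv frame₂ t = layerFrame-trans frame frame₁ ,
        (λ z → subst (IsGlb _ _) (sym (F₂.𝐅≡ (suc j) z))
                 (glb-resp (λ p∈ → ∈-sorted⁻ (Any.reverse⁻ p∈)) (λ p≤j → Any.reverse⁺ (∈-sorted⁺ p≤j))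
                   (λ {(p , y)} p∈ → cong (λ v → v ⊕ K p j y z ⊕ (arrival j - arrival p))
                     (sym (LayerFrame.𝐅≡ (layerFrame-trans frame frame₁) y (inject₁≢suc (∈-sorted⁻ (Any.reverse⁻ p∈))))))
                   (rows z))) ,
        t
        where
        open BlockInv inv
        module F₂ = TransformFrame frame₂
        frame₁ : LayerFrame (suc j) μ₁ μ
        frame₁ = record
          { 𝐅≡ = λ z _ → F₂.𝐅≡ _ z ; 𝐆≡ = F₂.𝐆≡ ; epochL≡ = F₂.epochL≡ ; epochU≡ = F₂.epochU≡ }

  record ProgramInv (done : List (Fin m)) (μ : Store) : Set where
    field
      known        : EpochsKnown μ
      initial      : InitialRow μ
      row          : ∀ {j} → j ∈ done → ∀ z →
                     IsGlb (λ (p , _) → p Fin.≤ j) (candidate μ j z) (μ 𝐅 (suc j) z)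
      transformed₀ : Transformed zero μ
      transformed  : ∀ {j} → j ∈ done → Transformed (suc j) μ

  program-spec : ∀ μ₀ → After program μ₀ (ProgramInv (reverse (allFin m)))
  program-spec μ₀ = epochExtrema-spec μ₀ » λ {μ₁} known → initialLayer-spec μ₁ » λ {μ₂} (frame₂ , initial) →
    transform-spec zero μ₂ » λ (frame₃ , t) →
    loop (allFin-sorted m) ProgramInv step (start known frame₂ initial frame₃ t)
    where
    start : ∀ {μ₁ μ₂ μ₃} → EpochsKnown μ₁ → LayerFrame zero μ₁ μ₂ → InitialRow μ₂ →
            TransformFrame zero μ₂ μ₃ → Transformed zero μ₃ → ProgramInv [] μ₃
    start {μ₁} {μ₂} {μ₃} known frame₂ initial frame₃ t = record
      { known        = epochsKnown-frame frame₃′ (epochsKnown-frame frame₂ known)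
      ; initial      = record { start = trans (F₃.𝐅≡ zero s₀) (InitialRow.start initial)
                              ; other = λ z ne → trans (F₃.𝐅≡ zero z) (InitialRow.other initial z ne) }
      ; row          = λ ()
      ; transformed₀ = t
      ; transformed  = λ ()
      }
      where
      module F₃ = TransformFrame frame₃
      frame₃′ : LayerFrame zero μ₂ μ₃
      frame₃′ = record
        { 𝐅≡ = λ z _ → F₃.𝐅≡ _ z ; 𝐆≡ = F₃.𝐆≡ ; epochL≡ = F₃.epochL≡ ; epochU≡ = F₃.epochU≡ }
    keep-transformed : ∀ {j r μ μ′} → LayerFrame (suc j) μ μ′ → r ≢ suc j → Transformed r μ → Transformed r μ′
    keep-transformed {r = r} {μ} {μ′} frame r≢ t x =
      subst (IsGlb _ _) (sym (LayerFrame.𝐆≡ frame x r≢))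
        (glb-resp (λ p → p) (λ p → p) (λ {y} _ → cong (_⊕ d y x) (sym (LayerFrame.𝐅≡ frame y r≢))) (t x))
    step : ∀ {done j μ} → Stage Fin._<_ (allFin m) done j → ProgramInv done μ →
           After (layer j) μ (ProgramInv (j ∷ done))
    step {done} {j} {μ} st inv = consequence extend
      (Layer.layer-spec j μ known λ {p} p≤j → below (inject₁ p) (subst (ℕ._≤ toℕ j) (sym (Fin.toℕ-inject₁ p)) p≤j))
      where
      open ProgramInv inv
      below : ∀ r → toℕ r ℕ.≤ toℕ j → Transformed r μ
      below zero     _   = transformed₀
      below (suc p)  p<j with Stage.future st (∈-allFin p)
      ... | inj₁ (here refl) = contradiction p<j (ℕ.<-irrefl refl)
      ... | inj₁ (there p∈)  = transformed p∈
      ... | inj₂ j<p         = contradiction p<j (ℕ.<⇒≯ j<p)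
      extend : ∀ {μ′} → LayerFrame (suc j) μ μ′ × Row j μ′ × Transformed (suc j) μ′ → ProgramInv (j ∷ done) μ′
      extend {μ′} (frame , new , t) = record
        { known        = epochsKnown-frame frame known
        ; initial      = record { start = trans (LayerFrame.𝐅≡ frame s₀ λ ()) (InitialRow.start initial)
                                ; other = λ z ne → trans (LayerFrame.𝐅≡ frame z λ ()) (InitialRow.other initial z ne) }
        ; row          = rows
        ; transformed₀ = keep-transformed frame (λ ()) transformed₀
        ; transformed  = λ { (here refl) → t ; (there k∈) → keep-transformed frame (earlier k∈) (transformed k∈) }
        }
        where
        earlier : ∀ {k} → k ∈ done → suc k ≢ suc j
        earlier k∈ refl = ℕ.<-irrefl refl (proj₂ (Stage.past st k∈))
        rows : ∀ {k} → k ∈ j ∷ done → ∀ z →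
               IsGlb (λ (p , _) → p Fin.≤ k) (candidate μ′ k z) (μ′ 𝐅 (suc k) z)
        rows (here refl) = new
        rows {k} (there k∈) z = subst (IsGlb _ _) (sym (LayerFrame.𝐅≡ frame z (earlier k∈)))
          (glb-resp (λ p → p) (λ p → p)
            (λ {(p , y)} p≤k → cong (λ v → v ⊕ K p k y z ⊕ (arrival k - arrival p))
              (sym (LayerFrame.𝐅≡ frame y (inject₁≢suc (ℕ.≤-trans p≤k (ℕ.<⇒≤ (proj₂ (Stage.past st k∈))))))))
            (row k∈ z))

  result-isTable : ∀ μ → IsTable (exec program μ 𝐅)
  result-isTable μ = record
    { F-start = InitialRow.start initial
    ; F-other = InitialRow.other initial
    ; F-step  = λ j z → glb-unique
        (glb-resp (λ p≤j → ∈-cartesianProduct⁺ (∈-filter⁺ (Fin._≤? j) (∈-allFin _) p≤j) (∈-allFin _))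
                  (λ py∈ → proj₂ (∈-filter⁻ (Fin._≤? j) {xs = allFin m}
                             (proj₁ (∈-cartesianProduct⁻ (upTo j) (allFin N) py∈))))
                  (λ _ → refl) (row (Any.reverse⁺ (∈-allFin j)) z))
        (minimum-glb (cartesianProduct (upTo j) (allFin N)) _)
    }
    where open ProgramInv (holds (program-spec μ))

-- Running time and space

module Cost (S : Shape) {k : ℕ} (layout : Vec Array k) where
  open Syntax S layout

  bound : Stmt → ℕ
  boundFor : ∀ {n} → List (Fin n) → (Fin n → Stmt) → ℕ
  bound skip                  = 1
  bound (A ⟨ r , c ⟩≔ e)      = 1 ℕ.+ exprSize r ℕ.+ exprSize c ℕ.+ exprSize e
  bound (s ⨾ s′)              = bound s ℕ.+ bound s′
  bound (if b then s else s′) = testSize b ℕ.+ (bound s ℕ.⊔ bound s′)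
  bound (for is s)            = boundFor is s
  boundFor []       s = 1
  boundFor (i ∷ is) s = 1 ℕ.+ bound (s i) ℕ.+ boundFor is s

  module _ {R : OrderedField} (I : Input R S) where
    open Semantics I layout

    time≤bound : ∀ s μ → time s μ ℕ.≤ bound s
    timeFor≤boundFor : ∀ {n} (is : List (Fin n)) s μ → timeFor is s μ ℕ.≤ boundFor is s
    time≤bound skip             μ = ℕ.≤-refl
    time≤bound (A ⟨ r , c ⟩≔ e) μ = ℕ.≤-refl
    time≤bound (s ⨾ s′)         μ = ℕ.+-mono-≤ (time≤bound s μ) (time≤bound s′ (exec s μ))
    time≤bound (if b then s else s′) μ with holds? b μ
    ... | yes _ = ℕ.+-monoʳ-≤ (testSize b) (ℕ.≤-trans (time≤bound s μ) (ℕ.m≤m⊔n _ _))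
    ... | no  _ = ℕ.+-monoʳ-≤ (testSize b) (ℕ.≤-trans (time≤bound s′ μ) (ℕ.m≤n⊔m _ _))
    time≤bound (for is s)       μ = timeFor≤boundFor is s μ
    timeFor≤boundFor []       s μ = ℕ.≤-refl
    timeFor≤boundFor (i ∷ is) s μ =
      ℕ.+-mono-≤ (ℕ.s≤s (time≤bound (s i) μ)) (timeFor≤boundFor is s (exec (s i) μ))

  -- A record, so that s, X and c can be inferred from the goal.
  record Runs (X : ℕ) (s : Stmt) (c : ℕ) : Set where
    constructor runs
    field
      within : bound s ℕ.≤ c ℕ.* X

  open Runs public

  straight : ∀ {X} → 1 ℕ.≤ X → ∀ s c → T (bound s ℕ.≤ᵇ c) → Runs X s c
  straight {X} 1≤X s c b≤c = runs (ℕ.≤-trans (ℕ.≤ᵇ⇒≤ _ _ b≤c)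
    (ℕ.≤-trans (ℕ.≤-reflexive (sym (ℕ.*-identityʳ c))) (ℕ.*-monoʳ-≤ c 1≤X)))

  infixr 2 _∙_
  _∙_ : ∀ {X s s′ c c′} → Runs X s c → Runs X s′ c′ → Runs X (s ⨾ s′) (c ℕ.+ c′)
  _∙_ {X} {c = c} {c′} (runs h) (runs h′) =
    runs (ℕ.≤-trans (ℕ.+-mono-≤ h h′) (ℕ.≤-reflexive (sym (ℕ.*-distribʳ-+ X c c′))))

  scale : ∀ {X Y s c} → X ℕ.≤ Y → Runs X s c → Runs Y s c
  scale {c = c} X≤Y (runs h) = runs (ℕ.≤-trans h (ℕ.*-monoʳ-≤ c X≤Y))

  boundFor-length : ∀ {n} (is : List (Fin n)) {s c} → (∀ i → bound (s i) ℕ.≤ c) →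
                    boundFor is s ℕ.≤ 1 ℕ.+ length is ℕ.* suc c
  boundFor-length []       h = ℕ.≤-refl
  boundFor-length (i ∷ is) {c = c} h = ℕ.≤-trans (ℕ.+-mono-≤ (ℕ.s≤s (h i)) (boundFor-length is h))
    (ℕ.≤-reflexive (ℕ.+-suc (suc c) (length is ℕ.* suc c)))

  repeat : ∀ {X n k} {is : List (Fin n)} {s : Fin n → Stmt} {c} → 1 ℕ.≤ X → 1 ℕ.≤ k → length is ℕ.≤ k →
           (∀ i → Runs X (s i) c) → Runs (k ℕ.* X) (for is s) (2 ℕ.+ c)
  repeat {X} {k = k} {is} {s} {c} 1≤X 1≤k len≤k h = runs (begin
    boundFor is s                              ≤⟨ boundFor-length is (within ∘ h) ⟩
    1 ℕ.+ length is ℕ.* suc (c ℕ.* X)          ≤⟨ ℕ.+-mono-≤ (ℕ.*-mono-≤ 1≤k 1≤X)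
                                                    (ℕ.*-mono-≤ len≤k (ℕ.+-monoˡ-≤ (c ℕ.* X) 1≤X)) ⟩
    k ℕ.* X ℕ.+ k ℕ.* (suc c ℕ.* X)            ≡⟨ cong (k ℕ.* X ℕ.+_) (trans (sym (ℕ.*-assoc k (suc c) X))
                                                    (trans (cong (ℕ._* X) (ℕ.*-comm k (suc c))) (ℕ.*-assoc (suc c) k X))) ⟩
    (2 ℕ.+ c) ℕ.* (k ℕ.* X)                    ∎)
    where open ℕ.≤-Reasoning

  auxiliaryMax-≤ : ∀ {n} (is : List (Fin n)) {s c} → (∀ i → auxiliary (s i) ℕ.≤ c) → auxiliaryMax is s ℕ.≤ c
  auxiliaryMax-≤ []       h = ℕ.z≤n
  auxiliaryMax-≤ (i ∷ is) h = ℕ.⊔-lub (h i) (auxiliaryMax-≤ is h)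

  record Uses (s : Stmt) (c : ℕ) : Set where
    constructor uses
    field
      peak : auxiliary s ℕ.≤ c

  open Uses public

  uses-straight : ∀ s {c} → T (auxiliary s ℕ.≤ᵇ c) → Uses s c
  uses-straight s h = uses (ℕ.≤ᵇ⇒≤ _ _ h)

  uses-⨾ : ∀ {s s′ c} → Uses s c → Uses s′ c → Uses (s ⨾ s′) c
  uses-⨾ (uses h) (uses h′) = uses (ℕ.⊔-lub h h′)

  uses-for : ∀ {n} {is : List (Fin n)} {s : Fin n → Stmt} {c} → (∀ i → Uses (s i) c) → Uses (for is s) (suc c)
  uses-for {is = is} h = uses (ℕ.s≤s (auxiliaryMax-≤ is (peak ∘ h)))

module Complexity (S : Shape) (1≤N : 1 ℕ.≤ Shape.N S) (1≤m : 1 ℕ.≤ Shape.m S) where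
  open Shape S
  open DistanceTransform S
  open Syntax S layout
  open Cost S layout

  1≤mN : 1 ℕ.≤ m ℕ.* N
  1≤mN = ℕ.*-mono-≤ 1≤m 1≤N

  N≤mN : N ℕ.≤ m ℕ.* N
  N≤mN = ℕ.m≤n*m N m ⦃ ℕ.>-nonZero 1≤m ⦄

  length-allFin : ∀ n → length (allFin n) ℕ.≤ n
  length-allFin n = ℕ.≤-reflexive (length-tabulate {n = n} id)

  perSite : ∀ {is} {s : Fin N → Stmt} c → length is ℕ.≤ N → (∀ z → T (bound (s z) ℕ.≤ᵇ c)) →
            Runs N (for is s) (2 ℕ.+ c)
  perSite c len≤N h = scale (ℕ.≤-reflexive (ℕ.*-identityʳ N))
    (repeat ℕ.≤-refl 1≤N len≤N λ z → straight ℕ.≤-refl _ c (h z))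

  length-reverse-allFin : ∀ n → length (reverse (allFin n)) ℕ.≤ n
  length-reverse-allFin n = ℕ.≤-trans (ℕ.≤-reflexive (length-reverse (allFin n))) (length-allFin n)

  -- Here and below the numerals are convenient upper bounds, not exact counts.
  transform-runs : ∀ h → Runs N (transform h) 200
  transform-runs h = (straight 1≤N _ 30 tt ∙ perSite 68 (length-allFin N) λ _ → tt) ∙
                     straight 1≤N _ 30 tt ∙ perSite 68 (length-reverse-allFin N) λ _ → tt

  initialLayer-runs : Runs N initialLayer 30
  initialLayer-runs = perSite 18 (length-allFin N) (λ _ → tt) ∙ straight 1≤N _ 10 tt

  layer-runs : ∀ j → Runs (m ℕ.* N) (layer j) 600
  layer-runs j = scale N≤mN (perSite 14 (length-allFin N) λ _ → tt) ∙ straight 1≤mN _ 10 tt ∙ straight 1≤mN _ 10 tt ∙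
    repeat {c = 362} 1≤N 1≤m (ℕ.≤-trans (ℕ.≤-reflexive (length-reverse (upTo j)))
        (ℕ.≤-trans (length-filter (Fin._≤? j) (allFin m)) (length-allFin m)))
      (λ p → straight 1≤N _ 30 tt ∙ straight 1≤N _ 30 tt ∙ perSite 300 (length-allFin N) (λ _ → tt)) ∙
    scale N≤mN (transform-runs (suc j))

  -- Every epoch has a request, so the per-epoch overhead is charged to its requests.
  epochExtrema-runs : Runs (1 ℕ.+ Q) epochExtrema 60
  epochExtrema-runs = runs (ℕ.≤-trans (sum-bound id)
    (ℕ.≤-trans (ℕ.m≤n+m _ 59) (ℕ.≤-reflexive (sym (ℕ.*-suc 60 Q)))))
    where
    epoch : Fin m → Stmt
    epoch h =
      epochL ⟨ o , at h ⟩≔ locationOf h (first h) ⨾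
      epochU ⟨ o , at h ⟩≔ locationOf h (first h) ⨾
      for (allFin (size h)) λ i →
        (if siteAt (epochL ⟨ o , at h ⟩) `≤ siteAt (locationOf h i)
           then skip else (epochL ⟨ o , at h ⟩≔ locationOf h i)) ⨾
        (if siteAt (locationOf h i) `≤ siteAt (epochU ⟨ o , at h ⟩)
           then skip else (epochU ⟨ o , at h ⟩≔ locationOf h i))

    -- `skip` stands for the step that the loop over the epochs takes itself.
    epoch-runs : ∀ h → Runs (size h) (skip ⨾ epoch h) 60
    epoch-runs h = straight 1≤size _ 8 tt ∙ straight 1≤size _ 10 tt ∙ straight 1≤size _ 10 tt ∙
      scale (ℕ.≤-reflexive (ℕ.*-identityʳ (size h)))
        (repeat {c = 30} ℕ.≤-refl 1≤size (length-allFin (size h)) λ i → straight ℕ.≤-refl _ 30 tt)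
      where
      1≤size : 1 ℕ.≤ size h
      1≤size = ℕ.>-nonZero⁻¹ (size h) ⦃ nonempty h ⦄

    sum-bound : ∀ {n} (f : Fin n → Fin m) →
                boundFor (tabulate f) epoch ℕ.≤ 1 ℕ.+ 60 ℕ.* Vec.sum (Vec.tabulate (size ∘ f))
    sum-bound {zero}  f = ℕ.≤-refl
    sum-bound {suc n} f = ℕ.≤-trans
      (ℕ.+-mono-≤ (within (epoch-runs (f zero))) (sum-bound (f ∘ suc)))
      (ℕ.≤-reflexive (trans (ℕ.+-suc _ _) (cong suc (sym (ℕ.*-distribˡ-+ 60 (size (f zero)) _)))))

  program-runs : Runs (Q ℕ.+ m ℕ.* m ℕ.* N) program 892
  program-runs = scale 1+Q≤X epochExtrema-runs ∙ scale N≤X initialLayer-runs ∙ scale N≤X (transform-runs zero) ∙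
    scale mmN≤X (repeat {c = 600} 1≤mN 1≤m (length-allFin m) layer-runs)
    where
    X = Q ℕ.+ m ℕ.* m ℕ.* N
    mmN = m ℕ.* (m ℕ.* N)
    mmN≤X : mmN ℕ.≤ X
    mmN≤X = ℕ.≤-trans (ℕ.≤-reflexive (sym (ℕ.*-assoc m m N))) (ℕ.m≤n+m _ Q)
    1≤mmN : 1 ℕ.≤ mmN
    1≤mmN = ℕ.*-mono-≤ 1≤m 1≤mN
    N≤X : N ℕ.≤ X
    N≤X = ℕ.≤-trans N≤mN (ℕ.≤-trans (ℕ.m≤n*m (m ℕ.* N) m ⦃ ℕ.>-nonZero 1≤m ⦄) mmN≤X)
    1+Q≤X : 1 ℕ.+ Q ℕ.≤ X
    1+Q≤X = ℕ.≤-trans (ℕ.+-monoˡ-≤ Q (ℕ.≤-trans 1≤mmN (ℕ.≤-reflexive (sym (ℕ.*-assoc m m N)))))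
      (ℕ.≤-reflexive (ℕ.+-comm _ Q))

  transform-uses : ∀ h → Uses (transform h) 40
  transform-uses h = uses-⨾
    (uses-⨾ (uses-straight _ tt) (uses-for λ _ → uses-straight _ tt))
    (uses-⨾ (uses-straight _ tt) (uses-for λ _ → uses-straight _ tt))

  layer-uses : ∀ j → Uses (layer j) 40
  layer-uses j =
    uses-⨾ (uses-for λ _ → uses-straight _ tt) $
    uses-⨾ (uses-straight _ tt) $
    uses-⨾ (uses-straight _ tt) $
    uses-⨾ (uses-for λ p → uses-⨾ (uses-straight _ tt) $ uses-⨾ (uses-straight _ tt) $
              uses-for λ _ → uses-straight _ tt) $
    transform-uses (suc j)

  program-uses : Uses program 41
  program-uses =
    uses-⨾ (uses-for λ h → uses-⨾ (uses-straight _ tt) $ uses-⨾ (uses-straight _ tt) $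
              uses-for λ _ → uses-straight _ tt) $
    uses-⨾ (uses-⨾ (uses-for λ _ → uses-straight _ tt) (uses-straight _ tt)) $
    uses-⨾ (uses (ℕ.m≤n⇒m≤1+n (peak (transform-uses zero)))) $
    uses-for layer-uses

  workingSpace-≤ : workingSpace ℕ.≤ 60 ℕ.* (m ℕ.* N)
  workingSpace-≤ = ℕ.≤-trans (ℕ.+-mono-≤ arrays (ℕ.≤-trans (peak program-uses) (ℕ.*-monoʳ-≤ 41 1≤mN)))
    (ℕ.≤-reflexive (sym (ℕ.*-distribʳ-+ (m ℕ.* N) 19 41)))
    where
    X = m ℕ.* N
    infixr 6 _⊞_
    _⊞_ : ∀ {a b c} → a ℕ.≤ X → b ℕ.≤ c ℕ.* X → a ℕ.+ b ℕ.≤ suc c ℕ.* X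
    _⊞_ = ℕ.+-mono-≤
    infixr 6 _⊞₂_
    _⊞₂_ : ∀ {b c} → suc m ℕ.* N ℕ.≤ 2 ℕ.* X → b ℕ.≤ c ℕ.* X → suc m ℕ.* N ℕ.+ b ℕ.≤ (2 ℕ.+ c) ℕ.* X
    _⊞₂_ {c = c} h h′ = ℕ.≤-trans (ℕ.+-mono-≤ h h′) (ℕ.≤-reflexive (sym (ℕ.*-distribʳ-+ X 2 c)))
    layers : suc m ℕ.* N ℕ.≤ 2 ℕ.* X
    layers = ℕ.+-mono-≤ N≤mN (ℕ.≤-reflexive (sym (ℕ.*-identityˡ X)))
    row : 1 ℕ.* m ℕ.≤ X
    row = ℕ.≤-trans (ℕ.≤-reflexive (ℕ.*-comm 1 m)) (ℕ.*-monoʳ-≤ m 1≤N)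
    arrays : Vec.sum (Vec.map (λ A → Array.rows A ℕ.* Array.cols A) layout) ℕ.≤ 19 ℕ.* X
    arrays = _⊞₂_ {c = 17} layers $ _⊞₂_ {c = 15} layers $ _⊞₂_ {c = 13} layers $
      _⊞_ {c = 12} ℕ.≤-refl $ _⊞_ {c = 11} ℕ.≤-refl $ _⊞_ {c = 10} ℕ.≤-refl $
      _⊞_ {c = 9} row $ _⊞_ {c = 8} row $
      _⊞_ {c = 7} 1≤mN $ _⊞_ {c = 6} 1≤mN $ _⊞_ {c = 5} 1≤mN $ _⊞_ {c = 4} 1≤mN $
      _⊞_ {c = 3} 1≤mN $ _⊞_ {c = 2} 1≤mN $ _⊞_ {c = 1} 1≤mN $ _⊞_ {c = 0} 1≤mN ℕ.z≤n

open import Data.Fin using (fromℕ)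
open import Data.List using (allFin)
open import Data.Nat using (ℕ; _+_; _*_; _≤_)
open import Data.Product using (_×_; ∃-syntax)
open OrderedField using (minimum)
open Shape using (N; m; Q)
open Model using (Table; IsTable; IsOPT)
open DistanceTransform using (workingSpace)
open DistanceTransform.Run using (WorkingMemory; result; runningTime)

theorem4p7 : (R : OrderedField) →
    ((S : Shape) (I : Input R S) (F : Table I) → IsTable I F →
    IsOPT I (minimum R (allFin (N S)) (λ z → F (fromℕ (m S)) z)))
    ×
    (∃[ C ] ((S : Shape) (I : Input R S) (μ : WorkingMemory S I) → 1 ≤ m S →
    IsTable I (result S I μ)
    × runningTime S I μ ≤ C * (Q S + m S * m S * N S)
    × workingSpace S ≤ C * (m S * N S)))
theorem4p7 R = (λ S I F isTable → UpperBound.optimal I isTable) , 892 , implementation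
  where
  implementation : (S : Shape) (I : Input R S) (μ : WorkingMemory S I) → 1 ≤ m S →
    IsTable I (result S I μ)
    × runningTime S I μ ≤ 892 * (Q S + m S * m S * N S)
    × workingSpace S ≤ 892 * (m S * N S)
  implementation S I μ 1≤m =
    Layers.result-isTable I μ ,
    ℕ.≤-trans (time≤bound I (program S) μ) (within program-runs) ,
    ℕ.≤-trans workingSpace-≤ (ℕ.*-monoˡ-≤ (m S * N S) (ℕ.≤ᵇ⇒≤ 60 892 tt))
    where
    open DistanceTransform using (program; layout)
    1≤N : 1 ≤ N S
    1≤N = ℕ.≤-trans (ℕ.s≤s ℕ.z≤n) (Fin.toℕ<n (Input.s₀ I))
    open Complexity S 1≤N 1≤m
    open Cost S (layout S)
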